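{- Let $G$ be a $k$-uniform block graph. Then $\overrightarrow{\chi}(G)\leq 3k-2$.
   Context: An orientation $D$ of a graph $G$ replaces each edge by exactly one of its two possible arcs; $d^-_D(v)$ is the indegree of $v$. $D$ is proper if adjacent vertices have distinct indegrees; a $k$-orientation has maximum indegree at most $k$. $\overrightarrow{\chi}(G)$ is the minimum $k$ such that $G$ admits a proper $k$-orientation. A block graph is a graph whose 2-connected components (blocks) are complete graphs; it is $k$-uniform if every block has exactly $k=\omega(G)$ vertices. -}

module Defs where

open import Data.Nat using (ℕ; _≤_)
open import Data.Bool using (Bool; true; false)
open import Data.Fin using (Fin)
open import Data.Fin.Subset using (Subset; _∈_; _⊆_; _-_; ∣_∣)
open import Data.Vec using (tabulate)
open import Data.Product using (_×_; Σ; ∃)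
open import Data.Sum using (_⊎_)
open import Relation.Nullary using (¬_)
open import Relation.Binary.PropositionalEquality using (_≡_; _≢_)

record Graph (n : ℕ) : Set where
  field
    adj     : Fin n → Fin n → Bool
    sym     : ∀ u v → adj u v ≡ adj v u
    irrefl  : ∀ v → adj v v ≡ false

open Graph public

module _ {n : ℕ} (G : Graph n) where

  Edge : Fin n → Fin n → Set
  Edge u v = adj G u v ≡ true

  data WalkIn (S : Subset n) : Fin n → Fin n → Set where
    here : ∀ {v} → v ∈ S → WalkIn S v v
    step : ∀ {u w v} → u ∈ S → Edge u w → WalkIn S w v → WalkIn S u v

  -- The induced subgraph G[S] is connected (empty set counts as connected).
  ConnectedIn : Subset n → Set
  ConnectedIn S = ∀ u v → u ∈ S → v ∈ S → WalkIn S u v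

  Nonseparable : Subset n → Set
  Nonseparable S =
    (∃ λ v → v ∈ S) × ConnectedIn S × (∀ v → v ∈ S → ConnectedIn (S - v))

  IsBlock : Subset n → Set
  IsBlock S = Nonseparable S × (∀ T → Nonseparable T → S ⊆ T → T ⊆ S)

  IsClique : Subset n → Set
  IsClique S = ∀ u v → u ∈ S → v ∈ S → u ≢ v → Edge u v

  CliqueNumber : ℕ → Set
  CliqueNumber k = (Σ (Subset n) λ S → IsClique S × ∣ S ∣ ≡ k)
                 × (∀ S → IsClique S → ∣ S ∣ ≤ k)

  IsBlockGraph : Set
  IsBlockGraph = ∀ S → IsBlock S → IsClique S

  UniformBlockGraph : ℕ → Set
  UniformBlockGraph k =
    IsBlockGraph × CliqueNumber k × (∀ S → IsBlock S → ∣ S ∣ ≡ k)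

  -- An orientation: arc u v = true means the edge uv is oriented u → v.
  -- Arcs only on edges, and each edge gets exactly one direction.
  record Orientation : Set where
    field
      arc      : Fin n → Fin n → Bool
      arc-edge : ∀ u v → arc u v ≡ true → Edge u v
      one-dir  : ∀ u v → Edge u v → (arc u v ≡ true × arc v u ≡ false)
                                    ⊎ (arc u v ≡ false × arc v u ≡ true)

  open Orientation public

  indeg : Orientation → Fin n → ℕ
  indeg D v = ∣ tabulate (λ u → arc D u v) ∣

  IsProper : Orientation → Set
  IsProper D = ∀ u v → Edge u v → indeg D u ≢ indeg D v

  ProperKOrientation : ℕ → Orientation → Set
  ProperKOrientation k D = IsProper D × (∀ v → indeg D v ≤ k)

  ProperOrientationNumber≤ : ℕ → Set
  ProperOrientationNumber≤ k = Σ Orientation (ProperKOrientation k)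

{-# OPTIONS --safe #-}
-- Write k = K + 1. The blocks of G make it a rooted forest of k-cliques in which every non-root
-- vertex v has a parent block, shared with its parent and its siblings, and some child blocks.
-- Orient each block transitively. The position p ≤ K of v in its parent block is then its indegree
-- within that block, and the position s of v in a child block is what that block adds.
-- Give each vertex a weight e ∈ {0, 1, 2}, computed from the leaves upwards, such that v can reach
-- indegree p + K e for every p ≥ 1 (and 0 for p = 0). Siblings then get distinct indegrees, since
-- their nonzero ones differ modulo K. A collision with the parent, of indegree r + K e, needs a child
-- of weight e at position r. It is avoided if the parent itself sits at r, or if a sibling
-- of another weight can be moved there; if all children have weight e = 2, the one at position r
-- has a second option among 3K + 1, 2K and r. With these rules the indegrees can be
-- chosen from the roots downwards, and none exceeds 3K + 1 = 3k - 2.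
module Submission where

open import Defs
open import Data.Bool using (true; false)
open import Data.Bool.Properties using () renaming (_≟_ to _≟ᵇ_)
open import Data.Empty using (⊥; ⊥-elim)
open import Data.Fin as Fin using (Fin; zero; suc; _≟_)
open import Data.Fin.Properties using (any?) renaming (suc-injective to Fin-suc-injective)
open import Data.Fin.Subset as Subset
  using (Subset; ⊤; ⁅_⁆; _∪_; _-_; _⊆_; _⊃_; ∣_∣)
  renaming (_∈_ to _∈ₛ_; _∉_ to _∉ₛ_)
open import Data.Fin.Subset.Induction using (⊃-wellFounded)
open import Data.Fin.Subset.Properties
  using (_∈?_; ∈⊤; ∉⊥; ⊆⊤; ⊆-antisym; x∈⁅x⁆; x∈⁅y⁆⇒x≡y; x∈p∪q⁻; p⊆p∪q; q⊆p∪q; x∈p∧x≢y⇒x∈p-y; p─q⊆p)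
open import Data.List using (List; []; _∷_; map; filter; allFin)
import Data.List.Membership.DecPropositional as DecMembership
open import Data.List.Membership.Propositional using (_∈_)
open import Data.List.Membership.Propositional.Properties using (∈-filter⁺; ∈-filter⁻; ∈-allFin)
open import Data.List.Properties using (map-cong-local)
open import Data.List.Relation.Binary.Pointwise using (Pointwise; []; _∷_)
open import Data.List.Relation.Unary.All as All using ([]; _∷_)
open import Data.List.Relation.Unary.AllPairs using ([]; _∷_)
open import Data.List.Relation.Unary.Any using (here; there)
open import Data.List.Relation.Unary.Unique.Propositional using (Unique)
open import Data.List.Relation.Unary.Unique.Propositional.Properties using (filter⁺; allFin⁺)
open import Data.Nat using (ℕ; zero; suc; _+_; _*_; _∸_; _⊓_; _≤_; _<_; z≤n; s≤s; s≤s⁻¹; _<?_; _≤?_)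
import Data.Nat as ℕ
open import Data.Nat.ListAction using (sum)
open import Data.Nat.Properties hiding (_≟_)
open import Data.Nat.Solver using (module +-*-Solver)
open import Data.Product using (_×_; _,_; proj₁; proj₂; ∃-syntax)
open import Data.Sum using (_⊎_; inj₁; inj₂; [_,_]′)
open import Data.Vec using (tabulate; there) renaming (_∷_ to _∷ᵛ_)
open import Data.Vec.Properties using ([]=⇒lookup; lookup⇒[]=; lookup∘tabulate)
open import Function using (_∘_; id; case_of_)
open import Induction.WellFounded using (Acc; acc)
open import Relation.Binary.Definitions using (DecidableEquality; tri<; tri≈; tri>)
open import Relation.Binary.PropositionalEquality as ≡
  using (_≡_; _≢_; refl; cong; cong₂; subst; trans)
open import Relation.Nullary using (¬_; Dec; yes; no; does; contradiction)
open import Relation.Nullary.Decidable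
  using (_×-dec_; _⊎-dec_; ¬?; dec-true; dec-false; decidable-stable)
open import Relation.Unary using (Decidable)

-- Counting the elements of decidable subsets of `Fin n`.

InjectiveOn : {A B : Set} → (A → Set) → (A → B) → Set
InjectiveOn P f = ∀ {x y} → P x → P y → f x ≡ f y → x ≡ y

-- Phrased as the size of a tabulated subset so that `indeg`, for arcs decided by a relation, is
-- such a count by definition.
# : ∀ {n} {P : Fin n → Set} → Decidable P → ℕ
# P? = ∣ tabulate (λ u → does (P? u)) ∣

#-⊎ : ∀ {n} {P Q R : Fin n → Set} (P? : Decidable P) (Q? : Decidable Q) (R? : Decidable R) →
  (∀ {u} → R u → P u ⊎ Q u) → (∀ {u} → P u → R u) → (∀ {u} → Q u → R u) →
  (∀ {u} → P u → ¬ Q u) → # R? ≡ # P? + # Q?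
#-⊎ {zero} _ _ _ _ _ _ _ = refl
#-⊎ {suc n} P? Q? R? split P⊆R Q⊆R disj
  with #-⊎ (P? ∘ suc) (Q? ∘ suc) (R? ∘ suc) split P⊆R Q⊆R disj | P? zero | Q? zero | R? zero
... | ih | yes p | yes q | _     = contradiction q (disj p)
... | ih | yes p | no _  | yes _ = cong suc ih
... | ih | yes p | no _  | no ¬r = contradiction (P⊆R p) ¬r
... | ih | no _  | yes q | yes _ = trans (cong suc ih) (≡.sym (+-suc _ _))
... | ih | no _  | yes q | no ¬r = contradiction (Q⊆R q) ¬r
... | ih | no ¬p | no ¬q | yes r = ⊥-elim ([ ¬p , ¬q ]′ (split r))
... | ih | no _  | no _  | no _  = ih

#-∅ : ∀ {n} {P : Fin n → Set} (P? : Decidable P) → (∀ {u} → ¬ P u) → # P? ≡ 0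
#-∅ {zero} P? ∅ = refl
#-∅ {suc n} P? ∅ with P? zero
... | yes p = contradiction p ∅
... | no _  = #-∅ (P? ∘ suc) ∅

#-mono : ∀ {n} {P Q : Fin n → Set} (P? : Decidable P) (Q? : Decidable Q) →
  (∀ {u} → P u → Q u) → # P? ≤ # Q?
#-mono {P = P} {Q} P? Q? P⊆Q = ≤-trans (m≤m+n (# P?) _)
  (≤-reflexive (≡.sym (#-⊎ P? (λ u → Q? u ×-dec ¬? (P? u)) Q? split P⊆Q proj₁ λ p q → proj₂ q p)))
  where
  split : ∀ {u} → Q u → P u ⊎ (Q u × ¬ P u)
  split {u} q with P? u
  ... | yes p = inj₁ p
  ... | no ¬p = inj₂ (q , ¬p)

#-cong : ∀ {n} {P Q : Fin n → Set} (P? : Decidable P) (Q? : Decidable Q) →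
  (∀ {u} → P u → Q u) → (∀ {u} → Q u → P u) → # P? ≡ # Q?
#-cong P? Q? P⊆Q Q⊆P = ≤-antisym (#-mono P? Q? P⊆Q) (#-mono Q? P? Q⊆P)

#-≤1 : ∀ {n} {P : Fin n → Set} (P? : Decidable P) → (∀ {u v} → P u → P v → u ≡ v) → # P? ≤ 1
#-≤1 {zero} P? unique = z≤n
#-≤1 {suc n} P? unique with P? zero
... | yes p = s≤s (≤-reflexive (#-∅ (P? ∘ suc) λ q → contradiction (unique p q) λ ()))
... | no _  = #-≤1 (P? ∘ suc) λ p q → Fin-suc-injective (unique p q)

#-≥1 : ∀ {n} {P : Fin n → Set} (P? : Decidable P) {v} → P v → 1 ≤ # P?
#-≥1 P? {zero} p with P? zero
... | yes _ = s≤s z≤n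
... | no ¬p = contradiction p ¬p
#-≥1 P? {suc v} p with P? zero
... | yes _ = s≤s z≤n
... | no _  = #-≥1 (P? ∘ suc) p

#-singleton : ∀ {n} (v : Fin n) → # (_≟ v) ≡ 1
#-singleton v = ≤-antisym (#-≤1 (_≟ v) λ p q → trans p (≡.sym q)) (#-≥1 (_≟ v) refl)

-- `f u` is the number of elements of `P` below `u`.
#-enumeration : ∀ {n} {P : Fin n → Set} (P? : Decidable P) →
  ∃[ f ] (∀ {u} → P u → f u < # P?) × InjectiveOn P f
#-enumeration {zero} P? = (λ ()) , (λ { {()} }) , λ { {()} }
#-enumeration {suc n} P? with P? zero | #-enumeration (P? ∘ suc)
... | yes _ | f , bound , inj = g , (λ {u} → g-bound {u}) , λ {u} {v} → g-inj {u} {v}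
  where
  g : Fin (suc n) → ℕ
  g zero    = 0
  g (suc u) = suc (f u)
  g-bound : ∀ {u} → _ → g u < suc (# (P? ∘ suc))
  g-bound {zero}  _ = s≤s z≤n
  g-bound {suc u} p = s≤s (bound p)
  g-inj : InjectiveOn _ g
  g-inj {zero}  {zero}  _ _ _ = refl
  g-inj {suc u} {suc v} p q e = cong suc (inj p q (suc-injective e))
... | no ¬p | f , bound , inj = g , (λ {u} → g-bound {u}) , λ {u} {v} → g-inj {u} {v}
  where
  g : Fin (suc n) → ℕ
  g zero    = 0
  g (suc u) = f u
  g-bound : ∀ {u} → _ → g u < # (P? ∘ suc)
  g-bound {zero}  p = contradiction p ¬p
  g-bound {suc u} p = bound p
  g-inj : InjectiveOn _ g
  g-inj {zero}  p _ _ = contradiction p ¬p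
  g-inj {suc u} {zero} _ p _ = contradiction p ¬p
  g-inj {suc u} {suc v} p q e = cong suc (inj p q e)

module _ {n : ℕ} {P : Fin n → Set} (P? : Decidable P) (f : Fin n → ℕ) (inj : InjectiveOn P f) where

  -- Pigeonhole by induction on the window length: by injectivity each further value `a + d` is
  -- taken at most once.
  #-window : ∀ a d → # (λ u → P? u ×-dec (a ≤? f u ×-dec f u <? a + d)) ≤ d
  #-window a zero = ≤-reflexive (#-∅ (λ u → P? u ×-dec (a ≤? f u ×-dec f u <? a + 0)) λ (_ , a≤f , f<a) →
    <⇒≱ f<a (≤-trans (≤-reflexive (+-identityʳ a)) a≤f))
  #-window a (suc d) = begin
    # W?              ≡⟨ #-⊎ L? E? W? split
                           (λ (p , l , h) → p , l , <-≤-trans h (+-monoʳ-≤ a (n≤1+n d)))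
                           (λ { (p , e) → p , subst (a ≤_) (≡.sym e) (m≤m+n a d)
                                            , subst (_< a + suc d) (≡.sym e) (+-monoʳ-< a (n<1+n d)) })
                           (λ (_ , _ , h) (_ , e) → <-irrefl e h) ⟩
    # L? + # E?       ≤⟨ +-mono-≤ (#-window a d)
                           (#-≤1 E? λ (p , e) (q , e′) → inj p q (trans e (≡.sym e′))) ⟩
    d + 1             ≡⟨ +-comm d 1 ⟩
    suc d             ∎
    where
    open ≤-Reasoning
    L? = λ u → P? u ×-dec (a ≤? f u ×-dec f u <? a + d)
    E? = λ u → P? u ×-dec (f u ℕ.≟ a + d)
    W? = λ u → P? u ×-dec (a ≤? f u ×-dec f u <? a + suc d)
    split : ∀ {u} → P u × a ≤ f u × f u < a + suc d →
      (P u × a ≤ f u × f u < a + d) ⊎ (P u × f u ≡ a + d)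
    split {u} (p , l , h) with m≤n⇒m<n∨m≡n (s≤s⁻¹ (subst (f u <_) (+-suc a d) h))
    ... | inj₁ f< = inj₁ (p , l , f<)
    ... | inj₂ f≡ = inj₂ (p , f≡)

  -- The windows `[0, p)` and `[p, k)` hold at most `p` and `k ∸ p` elements, yet all `k` elements
  -- lie in one of them, so both are full. This later turns a position in a transitively oriented
  -- block into an indegree.
  #-initial : ∀ {k p} → # P? ≡ k → (∀ {u} → P u → f u < k) → p ≤ k →
    # (λ u → P? u ×-dec f u <? p) ≡ p
  #-initial {k} {p} total bound p≤k = ≤-antisym upper (+-cancelʳ-≤ (k ∸ p) _ _ (begin
    p + (k ∸ p)         ≡⟨ m+[n∸m]≡n p≤k ⟩
    k                   ≡⟨ total ⟨
    # P?                ≡⟨ #-⊎ I? W? P? split proj₁ proj₁ (λ (_ , h) (_ , l , _) → <⇒≱ h l) ⟩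
    # I? + # W?         ≤⟨ +-monoʳ-≤ (# I?) (#-window p (k ∸ p)) ⟩
    # I? + (k ∸ p)      ∎))
    where
    open ≤-Reasoning
    I? = λ u → P? u ×-dec f u <? p
    W? = λ u → P? u ×-dec (p ≤? f u ×-dec f u <? p + (k ∸ p))
    upper : # I? ≤ p
    upper = ≤-trans (#-mono I? (λ u → P? u ×-dec (0 ≤? f u ×-dec f u <? 0 + p))
      λ (q , h) → q , z≤n , h) (#-window 0 p)
    split : ∀ {u} → P u → (P u × f u < p) ⊎ (P u × p ≤ f u × f u < p + (k ∸ p))
    split {u} q with f u <? p
    ... | yes h = inj₁ (q , h)
    ... | no ¬h = inj₂ (q , ≮⇒≥ ¬h , subst (f u <_) (≡.sym (m+[n∸m]≡n p≤k)) (bound q))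

-- Used with `g` the class map: the arcs entering a vertex from below are counted one child block at
-- a time.
#-fibres : ∀ {n} {R : Fin n → Set} (R? : Decidable R) (g : Fin n → Fin n) (s : Fin n → ℕ) {bs} →
  Unique bs → (∀ {u} → R u → g u ∈ bs) →
  (∀ {b} → b ∈ bs → # (λ u → R? u ×-dec g u ≟ b) ≡ s b) → # R? ≡ sum (map s bs)
#-fibres R? g s [] cover _ = #-∅ R? λ r → contradiction (cover r) λ ()
#-fibres {R = R} R? g s {b ∷ bs} (b∉ ∷ uniq) cover fibre =
  trans (#-⊎ F? R′? R? split proj₁ proj₁ λ (_ , e) (_ , ¬e) → ¬e e)
    (cong₂ _+_ (fibre (here refl)) (#-fibres R′? g s uniq cover′ fibre′))
  where
  F? = λ u → R? u ×-dec g u ≟ b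
  R′? = λ u → R? u ×-dec ¬? (g u ≟ b)
  split : ∀ {u} → R u → (R u × g u ≡ b) ⊎ (R u × g u ≢ b)
  split {u} r with g u ≟ b
  ... | yes e = inj₁ (r , e)
  ... | no ¬e = inj₂ (r , ¬e)
  cover′ : ∀ {u} → R u × g u ≢ b → g u ∈ bs
  cover′ (r , ¬e) with cover r
  ... | here e  = contradiction e ¬e
  ... | there m = m
  fibre′ : ∀ {c} → c ∈ bs → # (λ u → R′? u ×-dec g u ≟ c) ≡ s c
  fibre′ {c} m = trans (#-cong (λ u → R′? u ×-dec g u ≟ c) (λ u → R? u ×-dec g u ≟ c) (λ ((r , _) , e) → r , e)
    (λ { (r , refl) → (r , λ e → All.lookup b∉ m (≡.sym e)) , refl })) (fibre (there m))

-- Turns a list of values into a function. `Unique` prevents a later entry from overriding an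
-- earlier one; off the list the value is 0.
assign : ∀ {A : Set} → DecidableEquality A → ∀ {C : A → ℕ → Set} {bs} → Unique bs → ∀ {ts} → Pointwise C bs ts →
  ∃[ s ] map s bs ≡ ts × (∀ {b} → b ∈ bs → C b (s b))
assign _≟_ {bs = []} [] [] = (λ _ → 0) , refl , λ ()
assign _≟_ {C} {b ∷ bs} (b∉ ∷ uniq) {t ∷ ts} (c ∷ cs) with assign _≟_ uniq cs
... | s , eq , all = s′ , cong₂ _∷_ s′-here (trans (map-cong-local (All.map s′-there b∉)) eq) , all′
  where
  s′ : _ → ℕ
  s′ c with c ≟ b
  ... | yes _ = t
  ... | no _  = s c
  s′-here : s′ b ≡ t
  s′-here with b ≟ b
  ... | yes _ = refl
  ... | no ¬e = contradiction refl ¬e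
  s′-there : ∀ {c} → b ≢ c → s′ c ≡ s c
  s′-there {c} ¬e with c ≟ b
  ... | yes e = contradiction (≡.sym e) ¬e
  ... | no _  = refl
  all′ : ∀ {c} → c ∈ b ∷ bs → C c (s′ c)
  all′ (here refl) = subst (C b) (≡.sym s′-here) c
  all′ {c} (there m) = subst (C c) (≡.sym (s′-there (All.lookup b∉ m))) (all m)

-- Subsets given by decidable predicates.

does⇒ : ∀ {A : Set} (a? : Dec A) → does a? ≡ true → A
does⇒ (yes a) _ = a

⟦_⟧ : ∀ {n} {P : Fin n → Set} → Decidable P → Subset n
⟦ P? ⟧ = tabulate (λ u → does (P? u))

∈⟦⟧⁺ : ∀ {n} {P : Fin n → Set} (P? : Decidable P) {u} → P u → u ∈ₛ ⟦ P? ⟧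
∈⟦⟧⁺ P? {u} p = lookup⇒[]= u ⟦ P? ⟧ (trans (lookup∘tabulate _ u) (dec-true (P? u) p))

∈⟦⟧⁻ : ∀ {n} {P : Fin n → Set} (P? : Decidable P) {u} → u ∈ₛ ⟦ P? ⟧ → P u
∈⟦⟧⁻ P? {u} m = does⇒ (P? u) (trans (≡.sym (lookup∘tabulate _ u)) ([]=⇒lookup m))

x∉p-x⁻ : ∀ {n} (p : Subset n) x → x ∉ₛ p - x
x∉p-x⁻ (_ ∷ᵛ p) Fin.zero    ()
x∉p-x⁻ (_ ∷ᵛ p) (Fin.suc x) (there m) = x∉p-x⁻ p x m

x∉p-x : ∀ {n} {p : Subset n} {x y} → y ∈ₛ p - x → y ≢ x
x∉p-x {p = p} {x} m refl = x∉p-x⁻ p x m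

-- Walks, simple paths and nonseparable sets.

module GraphTheory {n : ℕ} (G : Graph n) where

  edge-sym : ∀ {u v} → Edge G u v → Edge G v u
  edge-sym {u} {v} = trans (sym G v u)

  edge⇒≢ : ∀ {u v} → Edge G u v → u ≢ v
  edge⇒≢ {u} e refl with () ← trans (≡.sym e) (irrefl G u)

  edge? : ∀ u v → Dec (Edge G u v)
  edge? u v = adj G u v ≟ᵇ true

  module _ {S : Subset n} where

    _++ʷ_ : ∀ {u v w} → WalkIn G S u v → WalkIn G S v w → WalkIn G S u w
    here _     ++ʷ q = q
    step u e p ++ʷ q = step u e (p ++ʷ q)

    endʷ : ∀ {u v} → WalkIn G S u v → v ∈ₛ S
    endʷ (here m)     = m
    endʷ (step _ _ p) = endʷ p

    snocʷ : ∀ {u v w} → WalkIn G S u v → Edge G v w → w ∈ₛ S → WalkIn G S u w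
    snocʷ p e m = p ++ʷ step (endʷ p) e (here m)

    reverseʷ : ∀ {u v} → WalkIn G S u v → WalkIn G S v u
    reverseʷ (here m)     = here m
    reverseʷ (step m e p) = snocʷ (reverseʷ p) (edge-sym e) m

    hub : ∀ z → (∀ {t} → t ∈ₛ S → WalkIn G S t z) → ConnectedIn G S
    hub z to-z u v mu mv = to-z mu ++ʷ reverseʷ (to-z mv)

    mapʷ : ∀ {T u v} → S ⊆ T → WalkIn G S u v → WalkIn G T u v
    mapʷ S⊆T (here m)     = here (S⊆T m)
    mapʷ S⊆T (step m e p) = step (S⊆T m) e (mapʷ S⊆T p)

  data Walk (P : Fin n → Set) : Fin n → Fin n → Set where
    here : ∀ {v} → P v → Walk P v v
    step : ∀ {u w v} → P u → Edge G u w → Walk P w v → Walk P u v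

  map-walk : ∀ {P Q : Fin n → Set} {u v} → (∀ {x} → P x → Q x) → Walk P u v → Walk Q u v
  map-walk f (here p)     = here (f p)
  map-walk f (step p e w) = step (f p) e (map-walk f w)

  snoc-walk : ∀ {P : Fin n → Set} {u v w} → Walk P u v → Edge G v w → P w → Walk P u w
  snoc-walk (here p)     e q = step p e (here q)
  snoc-walk (step p e w) f q = step p e (snoc-walk w f q)

  start-walk : ∀ {P : Fin n → Set} {u v} → Walk P u v → P u
  start-walk (here p)     = p
  start-walk (step p _ _) = p

  end-walk : ∀ {P : Fin n → Set} {u v} → Walk P u v → P v
  end-walk (here p)     = p
  end-walk (step _ _ w) = end-walk w

  reverse-walk : ∀ {P : Fin n → Set} {u v} → Walk P u v → Walk P v u
  reverse-walk (here p)     = here p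
  reverse-walk (step p e w) = snoc-walk (reverse-walk w) (edge-sym e) p

  -- Indexed by its vertex set, so that a simple path is at once a candidate subset for
  -- `Nonseparable`.
  data Path : Subset n → Fin n → Fin n → Set where
    here : ∀ {v} → Path ⁅ v ⁆ v v
    step : ∀ {S u w v} → u ∉ₛ S → Edge G u w → Path S w v → Path (⁅ u ⁆ ∪ S) u v

  path-start : ∀ {S u v} → Path S u v → u ∈ₛ S
  path-start here                   = x∈⁅x⁆ _
  path-start (step {S} {u} _ _ _)   = p⊆p∪q S (x∈⁅x⁆ u)

  private
    ∈-step : ∀ {S u} {t : Fin n} → t ∈ₛ ⁅ u ⁆ ∪ S → t ≡ u ⊎ t ∈ₛ S
    ∈-step {S} {u} m with x∈p∪q⁻ ⁅ u ⁆ S m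
    ... | inj₁ t∈u = inj₁ (x∈⁅y⁆⇒x≡y u t∈u)
    ... | inj₂ t∈S = inj₂ t∈S

  suffix : ∀ {S w v u} → Path S w v → u ∈ₛ S → ∃[ S′ ] Path S′ u v × S′ ⊆ S
  suffix {v = v} here m with refl ← x∈⁅y⁆⇒x≡y v m = ⁅ v ⁆ , here , id
  suffix {u = t} p@(step {S} {u} _ _ q) m with ∈-step m
  ... | inj₁ refl = _ , p , id
  ... | inj₂ t∈S with suffix q t∈S
  ...   | S′ , q′ , S′⊆S = S′ , q′ , λ m → q⊆p∪q ⁅ u ⁆ S (S′⊆S m)

  simplify : ∀ {P : Fin n → Set} {u v} → Walk P u v → ∃[ S ] Path S u v × (∀ {x} → x ∈ₛ S → P x)
  simplify {P} {v = v} (here p) = ⁅ v ⁆ , here , λ m → subst P (≡.sym (x∈⁅y⁆⇒x≡y v m)) p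
  simplify {P} {u} (step p e w) with simplify w
  ... | S , q , S⊆P with u ∈? S
  ...   | yes u∈S = let S′ , q′ , S′⊆S = suffix q u∈S in S′ , q′ , λ m → S⊆P (S′⊆S m)
  ...   | no u∉S  = ⁅ u ⁆ ∪ S , step u∉S e q , λ m → [ (λ { refl → p }) , S⊆P ]′ (∈-step m)

  to-end : ∀ {S u v t} → Path S u v → t ∈ₛ S → WalkIn G S t v
  to-end {v = v} here m with refl ← x∈⁅y⁆⇒x≡y v m = here m
  to-end (step {S} {u} _ e p) m with ∈-step m
  ... | inj₁ refl = step m e (mapʷ (q⊆p∪q ⁅ u ⁆ S) (to-end p (path-start p)))
  ... | inj₂ t∈S  = mapʷ (q⊆p∪q ⁅ u ⁆ S) (to-end p t∈S)

  to-start : ∀ {S u v t} → Path S u v → t ∈ₛ S → WalkIn G S t u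
  to-start p m = to-end p m ++ʷ reverseʷ (to-end p (path-start p))

  -- A simple path meets `z` at most once, so deleting `z` can block only one of the two directions
  -- from `t`.
  to-either-end : ∀ {S u v t z} → Path S u v → t ∈ₛ S → t ≢ z → WalkIn G (S - z) t u ⊎ WalkIn G (S - z) t v
  to-either-end {v = v} here m t≢z with refl ← x∈⁅y⁆⇒x≡y v m = inj₁ (here (x∈p∧x≢y⇒x∈p-y m t≢z))
  to-either-end {z = z} (step {S} {u} u∉S e p) m t≢z with ∈-step m | u ≟ z
  ... | inj₁ refl | _ = inj₁ (here (x∈p∧x≢y⇒x∈p-y m t≢z))
  ... | inj₂ t∈S | yes refl =
    inj₂ (mapʷ (λ x∈S → x∈p∧x≢y⇒x∈p-y (q⊆p∪q ⁅ u ⁆ S x∈S) λ { refl → u∉S x∈S }) (to-end p t∈S))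
  ... | inj₂ t∈S | no u≢z with to-either-end p t∈S t≢z
  ...   | inj₁ w = inj₁ (snocʷ (mapʷ grow w) (edge-sym e) (x∈p∧x≢y⇒x∈p-y (p⊆p∪q S (x∈⁅x⁆ u)) u≢z))
    where
    grow : S - z ⊆ (⁅ u ⁆ ∪ S) - z
    grow m = x∈p∧x≢y⇒x∈p-y (q⊆p∪q ⁅ u ⁆ S (p─q⊆p S ⁅ z ⁆ m)) (x∉p-x m)
  ...   | inj₂ w = inj₂ (mapʷ grow w)
    where
    grow : S - z ⊆ (⁅ u ⁆ ∪ S) - z
    grow m = x∈p∧x≢y⇒x∈p-y (q⊆p∪q ⁅ u ⁆ S (p─q⊆p S ⁅ z ⁆ m)) (x∉p-x m)

  -- Without `z` the path remains connected. Without a path vertex `r`, every other path vertex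
  -- still reaches an end of the path, and both ends are adjacent to `z`.
  cycle-nonseparable : ∀ {S x y z} → Path S x y → z ∉ₛ S → Edge G x z → Edge G y z → Nonseparable G (⁅ z ⁆ ∪ S)
  cycle-nonseparable {S} {x} {y} {z} p z∉S xz yz = (z , z∈C) , hub z to-z , connected-minus
    where
    z∈C : z ∈ₛ ⁅ z ⁆ ∪ S
    z∈C = p⊆p∪q S (x∈⁅x⁆ z)
    to-z : ∀ {t} → t ∈ₛ ⁅ z ⁆ ∪ S → WalkIn G (⁅ z ⁆ ∪ S) t z
    to-z m with ∈-step m
    ... | inj₁ refl = here m
    ... | inj₂ t∈S  = snocʷ (mapʷ (q⊆p∪q ⁅ z ⁆ S) (to-start p t∈S)) xz z∈C
    connected-minus : ∀ r → r ∈ₛ ⁅ z ⁆ ∪ S → ConnectedIn G ((⁅ z ⁆ ∪ S) - r)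
    connected-minus r _ with r ≟ z
    ... | yes refl = hub x λ m → mapʷ (λ s∈S → x∈p∧x≢y⇒x∈p-y (q⊆p∪q ⁅ z ⁆ S s∈S) λ { refl → z∉S s∈S })
      (to-start p ([ (λ t≡z → contradiction t≡z (x∉p-x m)) , id ]′ (∈-step (p─q⊆p (⁅ z ⁆ ∪ S) ⁅ r ⁆ m))))
    ... | no r≢z = hub z λ m → to-z′ m (∈-step (p─q⊆p (⁅ z ⁆ ∪ S) ⁅ r ⁆ m))
      where
      z∈C-r : z ∈ₛ (⁅ z ⁆ ∪ S) - r
      z∈C-r = x∈p∧x≢y⇒x∈p-y z∈C (r≢z ∘ ≡.sym)
      grow : S - r ⊆ (⁅ z ⁆ ∪ S) - r
      grow m = x∈p∧x≢y⇒x∈p-y (q⊆p∪q ⁅ z ⁆ S (p─q⊆p S ⁅ r ⁆ m)) (x∉p-x m)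
      to-z′ : ∀ {t} → t ∈ₛ (⁅ z ⁆ ∪ S) - r → t ≡ z ⊎ t ∈ₛ S → WalkIn G ((⁅ z ⁆ ∪ S) - r) t z
      to-z′ m (inj₁ refl) = here m
      to-z′ m (inj₂ t∈S) with to-either-end p t∈S (x∉p-x m)
      ... | inj₁ w = snocʷ (mapʷ grow w) xz z∈C-r
      ... | inj₂ w = snocʷ (mapʷ grow w) yz z∈C-r

  clique-nonseparable : ∀ {S z} → z ∈ₛ S → IsClique G S → Nonseparable G S
  clique-nonseparable {S} z∈S clique = (_ , z∈S) , connected id , λ v _ → connected (p─q⊆p S ⁅ v ⁆)
    where
    connected : ∀ {T} → T ⊆ S → ConnectedIn G T
    connected T⊆S u v u∈T v∈T with u ≟ v
    ... | yes refl = here u∈T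
    ... | no u≢v   = step u∈T (clique u v (T⊆S u∈T) (T⊆S v∈T) u≢v) (here v∈T)

  -- Keep enlarging a nonseparable set until it is maximal. Whether a larger one exists is not
  -- decided, hence the double negation; it is harmless because the block is used only to derive
  -- adjacency, which is decidable.
  in-block : ∀ {S} → Acc _⊃_ S → Nonseparable G S → ¬ ¬ (∃[ T ] S ⊆ T × IsBlock G T)
  in-block {S} (acc larger) nonsep none = none (S , id , nonsep , maximal)
    where
    maximal : ∀ T → Nonseparable G T → S ⊆ T → T ⊆ S
    maximal T nonsep-T S⊆T {x} x∈T with x ∈? S
    ... | yes x∈S = x∈S
    ... | no x∉S  = contradiction (λ (U , T⊆U , block) → none (U , (λ m → T⊆U (S⊆T m)) , block))
                      (in-block (larger (S⊆T , x , x∈T , x∉S)) nonsep-T)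

  -- Nonseparable sets in a block graph.

  module BlockGraph (blockGraph : IsBlockGraph G) where

    nonseparable-clique : ∀ {S} → Nonseparable G S → IsClique G S
    nonseparable-clique {S} nonsep u v u∈S v∈S u≢v = decidable-stable (edge? u v) λ ¬e →
      in-block (⊃-wellFounded S) nonsep λ (T , S⊆T , block) → ¬e (blockGraph T block u v (S⊆T u∈S) (S⊆T v∈S) u≢v)

    -- The walk shortens to a simple path missing `z`; with `z` it closes to a cycle, which is
    -- nonseparable and therefore a clique.
    bypass : ∀ {x y z} → Walk (_≢ z) x y → Edge G x z → Edge G y z → x ≢ y → Edge G x y
    bypass {x} {y} {z} w xz yz x≢y with simplify w
    ... | S , p , S≢z = nonseparable-clique (cycle-nonseparable p (λ z∈S → S≢z z∈S refl) xz yz) x y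
      (q⊆p∪q ⁅ z ⁆ S (path-start p)) (q⊆p∪q ⁅ z ⁆ S (endʷ (to-end p (path-start p)))) x≢y

-- Rooted forests of cliques and their extension by one clique.

-- The part of the graph inside A as a rooted forest of cliques: every vertex v of
-- positive rank lies in a clique consisting of par v and the class of v, and the
-- vertex cls v of that class serves as its name.
record CliqueForest {n : ℕ} (G : Graph n) (K : ℕ) (A : Subset n) : Set where
  field
    rk      : Fin n → ℕ
    par cls : Fin n → Fin n
    cls-∈   : ∀ {v} → v ∈ₛ A → cls v ∈ₛ A
    cls-cls : ∀ {v} → v ∈ₛ A → cls (cls v) ≡ cls v
    rk-cls  : ∀ {v} → v ∈ₛ A → rk (cls v) ≡ rk v
    par-cls : ∀ {v} → v ∈ₛ A → par (cls v) ≡ par v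
    root    : ∀ {v} → v ∈ₛ A → rk v ≡ 0 → cls v ≡ v
    par-∈   : ∀ {v} → v ∈ₛ A → rk v ≢ 0 → par v ∈ₛ A
    rk-par  : ∀ {v} → v ∈ₛ A → rk v ≢ 0 → rk v ≡ suc (rk (par v))
    edge-par : ∀ {v} → v ∈ₛ A → rk v ≢ 0 → Edge G (par v) v
    edge-cls : ∀ {u v} → u ∈ₛ A → v ∈ₛ A → cls u ≡ cls v → u ≢ v → Edge G u v
    edges    : ∀ {u v} → u ∈ₛ A → v ∈ₛ A → Edge G u v → cls u ≡ cls v
               ⊎ (rk v ≢ 0 × par v ≡ u) ⊎ (rk u ≢ 0 × par u ≡ v)
    size     : ∀ {v} → v ∈ₛ A → rk v ≢ 0 → # (λ u → u ∈? A ×-dec cls u ≟ cls v) ≡ K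

module _ {n : ℕ} (G : Graph n) (K : ℕ) where

  emptyForest : CliqueForest G K Subset.⊥
  emptyForest = record
    { rk = λ _ → 0 ; par = id ; cls = id
    ; cls-∈ = λ m → contradiction m ∉⊥ ; cls-cls = λ m → contradiction m ∉⊥
    ; rk-cls = λ m → contradiction m ∉⊥ ; par-cls = λ m → contradiction m ∉⊥
    ; root = λ m → contradiction m ∉⊥ ; par-∈ = λ m → contradiction m ∉⊥
    ; rk-par = λ m → contradiction m ∉⊥ ; edge-par = λ m → contradiction m ∉⊥
    ; edge-cls = λ m → contradiction m ∉⊥ ; edges = λ m → contradiction m ∉⊥
    ; size = λ m → contradiction m ∉⊥ }

  -- Adds an isolated root u₀ if r ≡ 0, and otherwise a clique N below the vertex w.
  module Extend {A : Subset n} (F : CliqueForest G K A) {N : Fin n → Set} (N? : Decidable N)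
    (r : ℕ) (w u₀ : Fin n)
    (u₀∈N      : N u₀)
    (fresh     : ∀ {v} → v ∈ₛ A → ¬ N v)
    (clique    : ∀ {u v} → N u → N v → u ≢ v → Edge G u v)
    (new-root  : r ≡ 0 → ∀ {v} → N v → v ≡ u₀)
    (top∈A     : r ≢ 0 → w ∈ₛ A)
    (top-rk    : r ≢ 0 → r ≡ suc (CliqueForest.rk F w))
    (top-edge  : r ≢ 0 → ∀ {v} → N v → Edge G w v)
    (size-N    : r ≢ 0 → # N? ≡ K)
    (cross     : ∀ {a v} → a ∈ₛ A → N v → Edge G a v → r ≢ 0 × w ≡ a)
    where
    open CliqueForest F
    open GraphTheory G using (edge-sym)

    private
      override : {B : Set} → (Fin n → B) → B → Fin n → B
      override f c v with N? v
      ... | yes _ = c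
      ... | no _  = f v

      new : ∀ {B : Set} (f : Fin n → B) c {v} → N v → override f c v ≡ c
      new f c {v} m with N? v
      ... | yes _ = refl
      ... | no ¬m = contradiction m ¬m

      old : ∀ {B : Set} (f : Fin n → B) c {v} → v ∈ₛ A → override f c v ≡ f v
      old f c {v} a with N? v
      ... | yes m = contradiction m (fresh a)
      ... | no _  = refl

      A′ = A ∪ ⟦ N? ⟧

      data Place (v : Fin n) : Set where
        isNew : N v → Place v
        isOld : v ∈ₛ A → Place v

      locate : ∀ {v} → v ∈ₛ A′ → Place v
      locate m with x∈p∪q⁻ A ⟦ N? ⟧ m
      ... | inj₁ a = isOld a
      ... | inj₂ b = isNew (∈⟦⟧⁻ N? b)

      old∈ : ∀ {v} → v ∈ₛ A → v ∈ₛ A′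
      old∈ = p⊆p∪q ⟦ N? ⟧

      new∈ : ∀ {v} → N v → v ∈ₛ A′
      new∈ m = q⊆p∪q A ⟦ N? ⟧ (∈⟦⟧⁺ N? m)

      rk′ = override rk r
      par′ = override par w
      cls′ = override cls u₀

      N-rk : ∀ {v} → N v → rk′ v ≡ r
      N-rk = new rk r

      N-par : ∀ {v} → N v → par′ v ≡ w
      N-par = new par w

      N-cls : ∀ {v} → N v → cls′ v ≡ u₀
      N-cls = new cls u₀

      A-rk : ∀ {v} → v ∈ₛ A → rk′ v ≡ rk v
      A-rk = old rk r

      A-par : ∀ {v} → v ∈ₛ A → par′ v ≡ par v
      A-par = old par w

      A-cls : ∀ {v} → v ∈ₛ A → cls′ v ≡ cls v
      A-cls = old cls u₀

      -- Names of old classes lie in `A`, while the new class is named by `u₀` outside `A`.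
      separate : ∀ {u v} → N u → v ∈ₛ A → cls′ u ≢ cls′ v
      separate m a e = fresh (cls-∈ a) (subst N (trans (≡.sym (N-cls m)) (trans e (A-cls a))) u₀∈N)

      ≢-transfer : ∀ {x y z : ℕ} → x ≡ y → x ≢ z → y ≢ z
      ≢-transfer refl ne = ne

      crossing : ∀ {u v} → u ∈ₛ A → N v → Edge G u v → rk′ v ≢ 0 × par′ v ≡ u
      crossing a m e with cross a m e
      ... | r≢0 , w≡u = ≢-transfer (≡.sym (N-rk m)) r≢0 , trans (N-par m) w≡u

    extended : CliqueForest G K A′
    extended = record
      { rk = rk′ ; par = par′ ; cls = cls′
      ; cls-∈ = λ m → cls-∈′ (locate m)
      ; cls-cls = λ m → cls-cls′ (locate m)
      ; rk-cls = λ m → rk-cls′ (locate m)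
      ; par-cls = λ m → par-cls′ (locate m)
      ; root = λ m → root′ (locate m)
      ; par-∈ = λ m → par-∈′ (locate m)
      ; rk-par = λ m → rk-par′ (locate m)
      ; edge-par = λ m → edge-par′ (locate m)
      ; edge-cls = λ m m′ → edge-cls′ (locate m) (locate m′)
      ; edges = λ m m′ → edges′ (locate m) (locate m′)
      ; size = λ m → size′ (locate m)
      }
      where
      cls-∈′ : ∀ {v} → Place v → cls′ v ∈ₛ A′
      cls-∈′ (isNew m) = subst (_∈ₛ A′) (≡.sym (N-cls m)) (new∈ u₀∈N)
      cls-∈′ (isOld a) = subst (_∈ₛ A′) (≡.sym (A-cls a)) (old∈ (cls-∈ a))

      through-cls : ∀ {B : Set} (f : Fin n → B) c {v} → Place v → (∀ {v} → v ∈ₛ A → f (cls v) ≡ f v) →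
        override f c (cls′ v) ≡ override f c v
      through-cls f c (isNew m) _ = trans (cong (override f c) (N-cls m)) (trans (new f c u₀∈N) (≡.sym (new f c m)))
      through-cls f c (isOld a) h = trans (cong (override f c) (A-cls a))
        (trans (old f c (cls-∈ a)) (trans (h a) (≡.sym (old f c a))))

      cls-cls′ : ∀ {v} → Place v → cls′ (cls′ v) ≡ cls′ v
      cls-cls′ p = through-cls cls u₀ p cls-cls

      rk-cls′ : ∀ {v} → Place v → rk′ (cls′ v) ≡ rk′ v
      rk-cls′ p = through-cls rk r p rk-cls

      par-cls′ : ∀ {v} → Place v → par′ (cls′ v) ≡ par′ v
      par-cls′ p = through-cls par w p par-cls

      root′ : ∀ {v} → Place v → rk′ v ≡ 0 → cls′ v ≡ v
      root′ (isNew m) z = trans (N-cls m) (≡.sym (new-root (trans (≡.sym (N-rk m)) z) m))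
      root′ (isOld a) z = trans (A-cls a) (root a (trans (≡.sym (A-rk a)) z))

      par-∈′ : ∀ {v} → Place v → rk′ v ≢ 0 → par′ v ∈ₛ A′
      par-∈′ (isNew m) nz = old∈ (subst (_∈ₛ A) (≡.sym (N-par m)) (top∈A (≢-transfer (N-rk m) nz)))
      par-∈′ (isOld a) nz = old∈ (subst (_∈ₛ A) (≡.sym (A-par a)) (par-∈ a (≢-transfer (A-rk a) nz)))

      rk-par′ : ∀ {v} → Place v → rk′ v ≢ 0 → rk′ v ≡ suc (rk′ (par′ v))
      rk-par′ (isNew m) nz = trans (N-rk m) (trans (top-rk r≢0)
        (cong suc (≡.sym (trans (cong rk′ (N-par m)) (A-rk (top∈A r≢0))))))
        where r≢0 = ≢-transfer (N-rk m) nz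
      rk-par′ (isOld a) nz = trans (A-rk a) (trans (rk-par a rk≢0)
        (cong suc (≡.sym (trans (cong rk′ (A-par a)) (A-rk (par-∈ a rk≢0))))))
        where rk≢0 = ≢-transfer (A-rk a) nz

      edge-par′ : ∀ {v} → Place v → rk′ v ≢ 0 → Edge G (par′ v) v
      edge-par′ {v} (isNew m) nz = subst (λ x → Edge G x v) (≡.sym (N-par m)) (top-edge (≢-transfer (N-rk m) nz) m)
      edge-par′ {v} (isOld a) nz = subst (λ x → Edge G x v) (≡.sym (A-par a)) (edge-par a (≢-transfer (A-rk a) nz))

      edge-cls′ : ∀ {u v} → Place u → Place v → cls′ u ≡ cls′ v → u ≢ v → Edge G u v
      edge-cls′ (isNew m) (isNew m′) _ ne = clique m m′ ne
      edge-cls′ (isNew m) (isOld a)  e _  = contradiction e (separate m a)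
      edge-cls′ (isOld a) (isNew m)  e _  = contradiction (≡.sym e) (separate m a)
      edge-cls′ (isOld a) (isOld b)  e ne = edge-cls a b (trans (≡.sym (A-cls a)) (trans e (A-cls b))) ne

      edges′ : ∀ {u v} → Place u → Place v → Edge G u v → cls′ u ≡ cls′ v
               ⊎ (rk′ v ≢ 0 × par′ v ≡ u) ⊎ (rk′ u ≢ 0 × par′ u ≡ v)
      edges′ (isNew m) (isNew m′) _ = inj₁ (trans (N-cls m) (≡.sym (N-cls m′)))
      edges′ (isNew m) (isOld a)  e = inj₂ (inj₂ (crossing a m (edge-sym e)))
      edges′ (isOld a) (isNew m)  e = inj₂ (inj₁ (crossing a m e))
      edges′ (isOld a) (isOld b)  e with edges a b e
      ... | inj₁ c = inj₁ (trans (A-cls a) (trans c (≡.sym (A-cls b))))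
      ... | inj₂ (inj₁ (nz , p)) = inj₂ (inj₁ (≢-transfer (≡.sym (A-rk b)) nz , trans (A-par b) p))
      ... | inj₂ (inj₂ (nz , p)) = inj₂ (inj₂ (≢-transfer (≡.sym (A-rk a)) nz , trans (A-par a) p))

      size′ : ∀ {v} → Place v → rk′ v ≢ 0 → # (λ u → u ∈? A′ ×-dec cls′ u ≟ cls′ v) ≡ K
      size′ {v} (isNew m) nz = trans (#-cong (λ u → u ∈? A′ ×-dec cls′ u ≟ cls′ v) N? to
          λ m′ → new∈ m′ , trans (N-cls m′) (≡.sym (N-cls m)))
        (size-N (≢-transfer (N-rk m) nz))
        where
        to : ∀ {u} → u ∈ₛ A′ × cls′ u ≡ cls′ v → N u
        to (u∈ , e) with locate u∈
        ... | isNew m′ = m′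
        ... | isOld a  = contradiction (≡.sym e) (separate m a)
      size′ {v} (isOld a) nz = trans (#-cong (λ u → u ∈? A′ ×-dec cls′ u ≟ cls′ v)
          (λ u → u ∈? A ×-dec cls u ≟ cls v) to
          λ (b , e) → old∈ b , trans (A-cls b) (trans e (≡.sym (A-cls a))))
        (size a (≢-transfer (A-rk a) nz))
        where
        to : ∀ {u} → u ∈ₛ A′ × cls′ u ≡ cls′ v → u ∈ₛ A × cls u ≡ cls v
        to (u∈ , e) with locate u∈
        ... | isNew m = contradiction e (separate m a)
        ... | isOld b = b , trans (≡.sym (A-cls b)) (trans e (A-cls a))

-- Exhausting a uniform block graph by a clique forest.

module Build {n : ℕ} (G : Graph n) (K : ℕ) (blockGraph : IsBlockGraph G)
  (uniform : ∀ S → IsBlock G S → ∣ S ∣ ≡ suc K) where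

  open GraphTheory G
  open BlockGraph blockGraph

  -- That is, every component of G - A is attached to at most one vertex of A.
  Separated : Subset n → Set
  Separated A = ∀ {x y u v} → x ∈ₛ A → y ∈ₛ A → Edge G x u → Walk (_∉ₛ A) u v → Edge G v y → x ≡ y

  module AddRoot {A : Subset n} (F : CliqueForest G K A) {u₀ : Fin n} (u₀∉A : u₀ ∉ₛ A)
    (isolated : ∀ {a v} → a ∈ₛ A → v ∉ₛ A → ¬ Edge G a v) where

    forest : CliqueForest G K (A ∪ ⟦ _≟ u₀ ⟧)
    forest = Extend.extended G K F (_≟ u₀) 0 u₀ u₀ refl (λ { a refl → u₀∉A a })
      (λ { refl refl ne → contradiction refl ne }) (λ _ → id)
      (contradiction refl) (contradiction refl) (contradiction refl) (contradiction refl)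
      (λ { a refl e → contradiction e (isolated a u₀∉A) })

    separated : Separated (A ∪ ⟦ _≟ u₀ ⟧)
    separated {x} {y} x∈ y∈ xu w vy with x∈p∪q⁻ A _ x∈ | x∈p∪q⁻ A _ y∈
    ... | inj₁ x∈A | _ = contradiction xu (isolated x∈A (λ a → start-walk w (p⊆p∪q _ a)))
    ... | _ | inj₁ y∈A = contradiction (edge-sym vy) (isolated y∈A (λ a → end-walk w (p⊆p∪q _ a)))
    ... | inj₂ x∈N | inj₂ y∈N = trans (∈⟦⟧⁻ (_≟ u₀) x∈N) (≡.sym (∈⟦⟧⁻ (_≟ u₀) y∈N))

  module AddBlock {A : Subset n} (F : CliqueForest G K A) (sep : Separated A) {u₀ w : Fin n}
    (u₀∉A : u₀ ∉ₛ A) (w∈A : w ∈ₛ A) (wu₀ : Edge G w u₀) where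

    -- `Q` is the block through the edge from `w` to `u₀`, described by adjacency alone so that it
    -- is decidable; `N` is this block without its top vertex `w`.
    N Q : Fin n → Set
    N x = Edge G w x × (x ≡ u₀ ⊎ Edge G u₀ x)
    Q x = N x ⊎ x ≡ w

    N? : Decidable N
    N? x = edge? w x ×-dec (x ≟ u₀ ⊎-dec edge? u₀ x)

    Q? : Decidable Q
    Q? x = N? x ⊎-dec x ≟ w

    u₀∈N : N u₀
    u₀∈N = wu₀ , inj₁ refl

    N-clique : ∀ {x y} → N x → N y → x ≢ y → Edge G x y
    N-clique (_ , inj₁ refl) (_ , inj₁ refl) x≢y = contradiction refl x≢y
    N-clique (_ , inj₁ refl) (_ , inj₂ uy)   _   = uy
    N-clique (_ , inj₂ ux)   (_ , inj₁ refl) _   = edge-sym ux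
    N-clique (wx , inj₂ ux)  (wy , inj₂ uy)  x≢y =
      -- The walk from `x` through `u₀` to `y` avoids `w`, which is adjacent to both ends.
      bypass (step (≢w wx) (edge-sym ux) (step (≢w wu₀) uy (here (≢w wy)))) (edge-sym wx) (edge-sym wy) x≢y
      where
      ≢w : ∀ {z} → Edge G w z → z ≢ w
      ≢w e z≡w = edge⇒≢ e (≡.sym z≡w)

    Q-clique : ∀ {x y} → Q x → Q y → x ≢ y → Edge G x y
    Q-clique (inj₁ x∈N)      (inj₁ y∈N)      x≢y = N-clique x∈N y∈N x≢y
    Q-clique (inj₁ (wx , _)) (inj₂ refl)     _   = edge-sym wx
    Q-clique (inj₂ refl)     (inj₁ (wy , _)) _   = wy
    Q-clique (inj₂ refl)     (inj₂ refl)     x≢y = contradiction refl x≢y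

    -- A nonseparable set containing `Q` is a clique, so each of its further vertices is adjacent to
    -- both `w` and `u₀` and thus already belongs to `Q`.
    Q-block : IsBlock G ⟦ Q? ⟧
    Q-block = clique-nonseparable (∈⟦⟧⁺ Q? (inj₂ refl))
                (λ _ _ x∈Q y∈Q → Q-clique (∈⟦⟧⁻ Q? x∈Q) (∈⟦⟧⁻ Q? y∈Q))
      , maximal
      where
      maximal : ∀ T → Nonseparable G T → ⟦ Q? ⟧ ⊆ T → T ⊆ ⟦ Q? ⟧
      maximal T nonsep Q⊆T {t} t∈T = ∈⟦⟧⁺ Q? (member (t ≟ w) (t ≟ u₀))
        where
        adjacent : ∀ {x} → Q x → x ≢ t → Edge G x t
        adjacent x∈Q = nonseparable-clique nonsep _ _ (Q⊆T (∈⟦⟧⁺ Q? x∈Q)) t∈T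
        member : Dec (t ≡ w) → Dec (t ≡ u₀) → Q t
        member (yes t≡w) _        = inj₂ t≡w
        member (no _)  (yes refl) = inj₁ u₀∈N
        member (no ≢w) (no ≢u₀)   =
          inj₁ (adjacent (inj₂ refl) (≢w ∘ ≡.sym) , inj₂ (adjacent (inj₁ u₀∈N) (≢u₀ ∘ ≡.sym)))

    #N : # N? ≡ K
    #N = suc-injective (begin
      suc (# N?)          ≡⟨ +-comm 1 (# N?) ⟩
      # N? + 1            ≡⟨ cong (# N? +_) (#-singleton w) ⟨
      # N? + # (_≟ w)     ≡⟨ #-⊎ N? (_≟ w) Q? id inj₁ inj₂ (λ { (ww , _) refl → edge⇒≢ ww refl }) ⟨
      # Q?                ≡⟨ uniform ⟦ Q? ⟧ Q-block ⟩
      suc K               ∎)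
      where open ≡.≡-Reasoning

    -- A vertex of `A` adjacent to `u₀` must be `w`: the single vertex `u₀` is a walk outside `A`
    -- joining the two.
    N-fresh : ∀ {x} → x ∈ₛ A → ¬ N x
    N-fresh x∈A (wx , inj₁ refl) = u₀∉A x∈A
    N-fresh x∈A (wx , inj₂ ux)   = edge⇒≢ wx (sep w∈A x∈A wu₀ (here u₀∉A) ux)

    N-cross : ∀ {a x} → a ∈ₛ A → N x → Edge G a x → w ≡ a
    N-cross a∈A x∈N@(wx , _) ax = sep w∈A a∈A wx (here (λ x∈A → N-fresh x∈A x∈N)) (edge-sym ax)

    forest : CliqueForest G K (A ∪ ⟦ N? ⟧)
    forest = Extend.extended G K F N? (suc (CliqueForest.rk F w)) w u₀ u₀∈N N-fresh N-clique
      (λ ()) (λ _ → w∈A) (λ _ → refl) (λ _ → proj₁) (λ _ → #N) λ a∈A x∈N ax → (λ ()) , N-cross a∈A x∈N ax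

    -- If `x ≢ y`, then for each `z` in `Q` other than `x` the walk from `p` to `y` continues inside
    -- the clique to `z` and misses `x`. Bypassing `x` makes `p` adjacent to all of `Q`, in
    -- particular to `w` and `u₀`, which puts `p` in `Q`.
    Q-separated : ∀ {x y p q} → Q x → Q y → Edge G x p → Walk (¬_ ∘ Q) p q → Edge G q y → x ≡ y
    Q-separated {x} {y} {p} x∈Q y∈Q xp walk qy with x ≟ y
    ... | yes x≡y = x≡y
    ... | no x≢y  = contradiction (inj₁ (adjacent (inj₂ refl) , inj₂ (adjacent (inj₁ u₀∈N)))) (start-walk walk)
      where
      ≢x : ∀ {z} → ¬ Q z → z ≢ x
      ≢x z∉Q refl = z∉Q x∈Q
      to-y : Walk (_≢ x) p y
      to-y = snoc-walk (map-walk ≢x walk) qy (x≢y ∘ ≡.sym)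
      to : ∀ {z} → Q z → z ≢ x → Walk (_≢ x) p z
      to {z} z∈Q z≢x with y ≟ z
      ... | yes refl = to-y
      ... | no y≢z   = snoc-walk to-y (Q-clique y∈Q z∈Q y≢z) z≢x
      adjacent : ∀ {z} → Q z → Edge G z p
      adjacent {z} z∈Q with z ≟ x
      ... | yes refl = xp
      ... | no z≢x   = edge-sym (bypass (to z∈Q z≢x) (edge-sym xp) (Q-clique z∈Q x∈Q z≢x)
                         λ { refl → start-walk walk z∈Q })

    avoids-Q : ∀ {z} → z ∉ₛ A ∪ ⟦ N? ⟧ → ¬ Q z
    avoids-Q z∉ (inj₁ z∈N)  = z∉ (q⊆p∪q A _ (∈⟦⟧⁺ N? z∈N))
    avoids-Q z∉ (inj₂ refl) = z∉ (p⊆p∪q _ w∈A)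

    -- Prolonged by `y`, the walk leads outside `A` to a neighbour of `w`, so separation of `A`
    -- gives `x ≡ w`. Then both ends lie in `Q`.
    old-new : ∀ {x y p q} → x ∈ₛ A → N y → Edge G x p → Walk (_∉ₛ (A ∪ ⟦ N? ⟧)) p q → Edge G q y → x ≡ y
    old-new x∈A y∈N@(wy , _) xp walk qy = Q-separated (inj₂ x≡w) (inj₁ y∈N) xp (map-walk avoids-Q walk) qy
      where
      x≡w = sep x∈A w∈A xp (snoc-walk (map-walk (_∘ p⊆p∪q _) walk) qy (λ y∈A → N-fresh y∈A y∈N)) (edge-sym wy)

    separated : Separated (A ∪ ⟦ N? ⟧)
    separated x∈ y∈ xp walk qy with x∈p∪q⁻ A _ x∈ | x∈p∪q⁻ A _ y∈
    ... | inj₁ x∈A | inj₁ y∈A = sep x∈A y∈A xp (map-walk (_∘ p⊆p∪q _) walk) qy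
    ... | inj₂ x∈N | inj₂ y∈N = Q-separated (inj₁ (∈⟦⟧⁻ N? x∈N)) (inj₁ (∈⟦⟧⁻ N? y∈N)) xp (map-walk avoids-Q walk) qy
    ... | inj₁ x∈A | inj₂ y∈N = old-new x∈A (∈⟦⟧⁻ N? y∈N) xp walk qy
    ... | inj₂ x∈N | inj₁ y∈A = ≡.sym (old-new y∈A (∈⟦⟧⁻ N? x∈N) (edge-sym qy) (reverse-walk walk) (edge-sym xp))

  -- A block is added whenever some edge leaves `A`. A new root is started only when none does,
  -- which is the isolation that a root requires.
  build : ∀ {A} → Acc _⊃_ A → CliqueForest G K A → Separated A → CliqueForest G K ⊤
  build {A} (acc larger) F sep with any? (λ u → ¬? (u ∈? A) ×-dec any? (λ w → w ∈? A ×-dec edge? w u))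
  ... | yes (u , u∉A , w , w∈A , wu) = build (larger (p⊆p∪q _ , u , q⊆p∪q A _ (∈⟦⟧⁺ N? u∈N) , u∉A)) forest separated
    where
    open AddBlock F sep u∉A w∈A wu renaming (u₀∈N to u∈N)
  ... | no no-edge with any? (λ u → ¬? (u ∈? A))
  ...   | yes (u , u∉A) = build (larger (p⊆p∪q _ , u , q⊆p∪q A _ (∈⟦⟧⁺ (_≟ u) refl) , u∉A)) forest separated
    where
    open AddRoot F u∉A (λ a∈A v∉A av → no-edge (_ , v∉A , _ , a∈A , av))
  ...   | no all-in = subst (CliqueForest G K)
    (⊆-antisym ⊆⊤ λ {u} _ → decidable-stable (u ∈? A) λ u∉A → all-in (u , u∉A)) F

  cliqueForest : CliqueForest G K ⊤
  cliqueForest = build (⊃-wellFounded _) (emptyForest G K) λ x∈⊥ → contradiction x∈⊥ ∉⊥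

-- Residues modulo `K` and relabellings of positions.

≤⇒≢+ : ∀ {K r r′ e} → r ≤ K → 1 ≤ r′ → r ≢ r′ + K * suc e
≤⇒≢+ {K} {r} {r′} {e} r≤K 1≤r′ eq = <⇒≱ (begin-strict
  K                 ≡⟨ *-identityʳ K ⟨
  K * 1             ≤⟨ *-monoʳ-≤ K (s≤s z≤n) ⟩
  K * suc e         <⟨ m<n+m (K * suc e) 1≤r′ ⟩
  r′ + K * suc e    ≡⟨ eq ⟨
  r                 ∎) r≤K
  where open ≤-Reasoning

-- Residues are represented by 1, ..., K instead of 0, ..., K - 1, because position 0 always goes
-- with indegree 0 and is treated apart.
residue-unique : ∀ {K r r′} e e′ → 1 ≤ r → r ≤ K → 1 ≤ r′ → r′ ≤ K →
  r + K * e ≡ r′ + K * e′ → r ≡ r′ × e ≡ e′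
residue-unique {K} zero zero _ _ _ _ eq = +-cancelʳ-≡ (K * 0) _ _ eq , refl
residue-unique {K} {r} zero (suc e′) _ r≤K 1≤r′ _ eq =
  contradiction (trans (≡.sym (trans (cong (r +_) (*-zeroʳ K)) (+-identityʳ r))) eq) (≤⇒≢+ r≤K 1≤r′)
residue-unique {K} {r} {r′} (suc e) zero 1≤r _ _ r′≤K eq =
  contradiction (trans (≡.sym (trans (cong (r′ +_) (*-zeroʳ K)) (+-identityʳ r′))) (≡.sym eq)) (≤⇒≢+ r′≤K 1≤r)
residue-unique {K} {r} {r′} (suc e) (suc e′) 1≤r r≤K 1≤r′ r′≤K eq =
  let r≡ , e≡ = residue-unique e e′ 1≤r r≤K 1≤r′ r′≤K
                  (+-cancelʳ-≡ K _ _ (trans (shift r e) (trans eq (≡.sym (shift r′ e′)))))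
  in r≡ , cong suc e≡
  where
  shift : ∀ r e → r + K * e + K ≡ r + K * suc e
  shift r e = solve 3 (λ r e K → r :+ K :* e :+ K := r :+ K :* (con 1 :+ e)) refl r e K
    where open +-*-Solver

-- The increasing enumeration of the natural numbers other than `s`.
skip : ℕ → ℕ → ℕ
skip s i with i <? s
... | yes _ = i
... | no  _ = suc i

skip-≢ : ∀ s i → skip s i ≢ s
skip-≢ s i with i <? s
... | yes i<s = <⇒≢ i<s
... | no i≮s  = λ eq → i≮s (≤-reflexive eq)

skip-≤ : ∀ s i → skip s i ≤ suc i
skip-≤ s i with i <? s
... | yes _ = n≤1+n i
... | no  _ = ≤-refl

skip-injective : ∀ s {i j} → skip s i ≡ skip s j → i ≡ j
skip-injective s {i} {j} eq with i <? s | j <? s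
... | yes _   | yes _   = eq
... | no _    | no _    = suc-injective eq
... | yes i<s | no j≮s  = contradiction (≤-<-trans (≤-trans (n≤1+n j) (≤-reflexive (≡.sym eq))) i<s) j≮s
... | no i≮s  | yes j<s = contradiction (≤-<-trans (≤-trans (n≤1+n i) (≤-reflexive eq)) j<s) i≮s

swap : ℕ → ℕ → ℕ → ℕ
swap a b x with x ℕ.≟ a | x ℕ.≟ b
... | yes _ | _     = b
... | no _  | yes _ = a
... | no _  | no _  = x

swap-cases : ∀ a b x → (x ≡ a × swap a b x ≡ b) ⊎ (x ≡ b × swap a b x ≡ a) ⊎ (x ≢ a × x ≢ b × swap a b x ≡ x)
swap-cases a b x with x ℕ.≟ a | x ℕ.≟ b
... | yes e | _     = inj₁ (e , refl)
... | no _  | yes e = inj₂ (inj₁ (e , refl))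
... | no ¬e | no ¬f = inj₂ (inj₂ (¬e , ¬f , refl))

swap-left : ∀ a b → swap a b a ≡ b
swap-left a b with swap-cases a b a
... | inj₁ (_ , e)               = e
... | inj₂ (inj₁ (a≡b , e))      = trans e a≡b
... | inj₂ (inj₂ (a≢a , _ , _))  = contradiction refl a≢a

swap-injective : ∀ a b {x y} → swap a b x ≡ swap a b y → x ≡ y
swap-injective a b {x} {y} eq with swap-cases a b x | swap-cases a b y
... | inj₁ (x≡ , _) | inj₁ (y≡ , _) = trans x≡ (≡.sym y≡)
... | inj₁ (refl , e) | inj₂ (inj₁ (refl , f)) = trans (≡.sym f) (trans (≡.sym eq) e)
... | inj₁ (refl , e) | inj₂ (inj₂ (_ , y≢b , f)) = contradiction (trans (≡.sym f) (trans (≡.sym eq) e)) y≢b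
... | inj₂ (inj₁ (refl , e)) | inj₁ (refl , f) = trans (≡.sym f) (trans (≡.sym eq) e)
... | inj₂ (inj₁ (x≡ , _)) | inj₂ (inj₁ (y≡ , _)) = trans x≡ (≡.sym y≡)
... | inj₂ (inj₁ (refl , e)) | inj₂ (inj₂ (y≢a , _ , f)) = contradiction (trans (≡.sym f) (trans (≡.sym eq) e)) y≢a
... | inj₂ (inj₂ (_ , x≢b , e)) | inj₁ (refl , f) = contradiction (trans (≡.sym e) (trans eq f)) x≢b
... | inj₂ (inj₂ (x≢a , _ , e)) | inj₂ (inj₁ (refl , f)) = contradiction (trans (≡.sym e) (trans eq f)) x≢a
... | inj₂ (inj₂ (_ , _ , e)) | inj₂ (inj₂ (_ , _ , f)) = trans (≡.sym e) (trans eq f)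

-- Positions of the vertices of a block below its top vertex.

module _ {n : ℕ} {P : Fin n → Set} (P? : Decidable P) {K s : ℕ} (#P : # P? ≡ K) (s≤K : s ≤ K) where

  -- Position `s` is reserved for the top vertex. The bound by `K` holds off `P` too, so that a
  -- state can be formed for every vertex.
  record Positions : Set where
    field
      pos     : Fin n → ℕ
      pos≤    : ∀ u → pos u ≤ K
      pos≢    : ∀ {u} → P u → pos u ≢ s
      pos-inj : InjectiveOn P pos

  open Positions

  positions : Positions
  positions with #-enumeration P?
  ... | idx , bound , inj = record
    -- The cap makes the bound unconditional; on `P` it changes nothing, since there `idx u` is
    -- below `K`.
    { pos = λ u → skip s (idx u) ⊓ K
    ; pos≤ = λ u → m⊓n≤n _ K
    ; pos≢ = λ p e → skip-≢ s _ (trans (≡.sym (exact p)) e)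
    ; pos-inj = λ p q e → inj p q (skip-injective s (trans (≡.sym (exact p)) (trans e (exact q))))
    }
    where
    exact : ∀ {u} → P u → skip s (idx u) ⊓ K ≡ skip s (idx u)
    exact p = m≤n⇒m⊓n≡m (≤-trans (skip-≤ s _) (subst (idx _ <_) #P (bound p)))

  -- Compose any arrangement with the transposition of `r` and the position of `m`; neither of the
  -- two is `s`, so `s` stays free.
  positions-at : ∀ {m r} → P m → r ≤ K → r ≢ s → ∃[ π ] pos π m ≡ r
  positions-at {m} {r} Pm r≤K r≢s = record
    { pos = λ u → swap a r (pos π u)
    ; pos≤ = le
    ; pos≢ = ne
    ; pos-inj = λ p q e → pos-inj π p q (swap-injective a r e)
    } , swap-left a r
    where
    π = positions
    a = pos π m
    le : ∀ u → swap a r (pos π u) ≤ K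
    le u with swap-cases a r (pos π u)
    ... | inj₁ (_ , e) = subst (_≤ K) (≡.sym e) r≤K
    ... | inj₂ (inj₁ (_ , e)) = subst (_≤ K) (≡.sym e) (pos≤ π m)
    ... | inj₂ (inj₂ (_ , _ , e)) = subst (_≤ K) (≡.sym e) (pos≤ π u)
    ne : ∀ {u} → P u → swap a r (pos π u) ≢ s
    ne {u} p eq with swap-cases a r (pos π u)
    ... | inj₁ (_ , e) = r≢s (trans (≡.sym e) eq)
    ... | inj₂ (inj₁ (_ , e)) = pos≢ π Pm (trans (≡.sym e) eq)
    ... | inj₂ (inj₂ (_ , _ , e)) = pos≢ π p (trans (≡.sym e) eq)

-- Indegrees that a vertex can realise through its child blocks.

zeros : ∀ {A : Set} → List A → List ℕ
zeros = map (λ _ → 0)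

sum-zeros : ∀ {A : Set} (bs : List A) → sum (zeros bs) ≡ 0
sum-zeros []       = refl
sum-zeros (_ ∷ bs) = sum-zeros bs

module Fillings {B : Set} (K : ℕ) (1≤K : 1 ≤ K) (wt : B → ℕ) where

  -- Good b s t says that t is compatible, as the indegree of the top vertex of block b, with
  -- s arcs from the block to its top vertex: at most one position r of the block can produce
  -- the value t, and that position is occupied by the top vertex itself (s ≡ r), can be given to
  -- a vertex of a different weight, or can be given to a vertex with a second option (2 ≤ e).
  data Good (b : B) (s : ℕ) : ℕ → Set where
    vanishing : s ≡ 0 → Good b s 0
    residue   : ∀ r e → 1 ≤ r → r ≤ K → 2 ≤ e ⊎ s ≡ r ⊎ wt b ≢ e → Good b s (r + K * e)

  Admissible : B → ℕ → ℕ → Set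
  Admissible b t s = s ≤ K × Good b s t

  -- The parent block gives `p` arcs and the child blocks give `ss`, in total `t`. The bound is 3k -
  -- 2 for k = K + 1.
  Filling : List B → ℕ → ℕ → Set
  Filling bs p t = ∃[ ss ] Pointwise (λ b → Admissible b t) bs ss × p + sum ss ≡ t × t ≤ 1 + K * 3

  pad : ∀ {t} bs → (∀ b → Admissible b t 0) → Pointwise (λ b → Admissible b t) bs (zeros bs)
  pad []       _ = []
  pad (b ∷ bs) a = a b ∷ pad bs a

  -- For a single block b, what matters is that 1 ∸ wt b is at most 1 and differs from wt b.
  weigh : List B → ℕ
  weigh []          = 0
  weigh (b ∷ [])    = 1 ∸ wt b
  weigh (_ ∷ _ ∷ _) = 2

  filling-0 : ∀ bs → Filling bs 0 0
  filling-0 bs = zeros bs , pad bs (λ _ → z≤n , vanishing refl) , sum-zeros bs , z≤n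

  private
    3K : ∀ {p e} → p ≤ K → e ≤ 2 → p + K * e ≤ 1 + K * 3
    3K {p} {e} p≤K e≤2 = begin
      p + K * e    ≤⟨ +-mono-≤ p≤K (*-monoʳ-≤ K e≤2) ⟩
      K + K * 2    ≡⟨ *-suc K 2 ⟨
      K * 3        ≤⟨ n≤1+n _ ⟩
      1 + K * 3    ∎
      where open ≤-Reasoning

    1∸n≢n : ∀ n → n ≢ 1 ∸ n
    1∸n≢n zero ()
    1∸n≢n (suc n) eq with () ← trans eq (0∸n≡0 n)

  module _ {p} (1≤p : 1 ≤ p) (p≤K : p ≤ K) where

    -- A single block gives 0 or `K` arcs so that the multiple of `K` differs from the weight of its
    -- name; with more blocks the first two give `K` each, and `2 ≤ e` makes every block good.
    filling-weigh : ∀ bs → Filling bs p (p + K * weigh bs)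
    filling-weigh [] = [] , [] , cong (p +_) (≡.sym (*-zeroʳ K)) , 3K p≤K z≤n
    filling-weigh (b ∷ []) = s ∷ [] , (s≤K , residue p (1 ∸ wt b) 1≤p p≤K (inj₂ (inj₂ (1∸n≢n (wt b)))))∷ []
      , cong (p +_) (+-identityʳ s) , 3K p≤K (≤-trans (m∸n≤m 1 (wt b)) (n≤1+n 1))
      where
      s = K * (1 ∸ wt b)
      s≤K : s ≤ K
      s≤K = ≤-trans (*-monoʳ-≤ K (m∸n≤m 1 (wt b))) (≤-reflexive (*-identityʳ K))
    filling-weigh (b ∷ b′ ∷ bs) = K ∷ K ∷ zeros bs , good ≤-refl ∷ good ≤-refl ∷ pad bs (λ _ → good z≤n)
      , cong (p +_) eq , 3K p≤K ≤-refl
      where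
      good : ∀ {b s} → s ≤ K → Admissible b (p + K * 2) s
      good s≤K = s≤K , residue p 2 1≤p p≤K (inj₁ ≤-refl)
      eq : K + (K + sum (zeros bs)) ≡ K * 2
      eq = trans (cong (λ x → K + (K + x)) (sum-zeros bs))
             (solve 1 (λ K → K :+ (K :+ con 0) := K :* con 2) refl K)
        where open +-*-Solver

    -- The second options at position `p`. Each is written as `r + K * e` with `e` equal to 3, 1 or
    -- 0, hence never 2.
    data Alternative : ℕ → Set where
      high   : Alternative (1 + K * 3)
      middle : Alternative (K + K * 1)
      low    : Alternative (p + K * 0)

    filling-alternative : ∀ bs → weigh bs ≡ 2 → ∃[ t ] Alternative t × Filling bs p t
    filling-alternative [] ()
    filling-alternative (b ∷ []) eq = contradiction (subst (_≤ 1) eq (m∸n≤m 1 (wt b))) λ { (s≤s ()) }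
    -- The third block supplies the rest `1 + K ∸ p`, which is at most `K` because `1 ≤ p`.
    filling-alternative (b ∷ b′ ∷ b″ ∷ bs) _ = 1 + K * 3 , high , K ∷ K ∷ (1 + K ∸ p) ∷ zeros bs
      , good ≤-refl ∷ good ≤-refl ∷ good 1+K∸p≤K ∷ pad bs (λ _ → good z≤n) , eq , ≤-refl
      where
      good : ∀ {b s} → s ≤ K → Admissible b (1 + K * 3) s
      good s≤K = s≤K , residue 1 3 ≤-refl 1≤K (inj₁ (s≤s (s≤s z≤n)))
      1+K∸p≤K : 1 + K ∸ p ≤ K
      1+K∸p≤K = ∸-monoʳ-≤ (1 + K) 1≤p
      eq : p + (K + (K + (1 + K ∸ p + sum (zeros bs)))) ≡ 1 + K * 3
      eq = begin
        p + (K + (K + (1 + K ∸ p + sum (zeros bs))))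
          ≡⟨ solve 4 (λ p K q z → p :+ (K :+ (K :+ (q :+ z))) := (p :+ q) :+ (K :+ (K :+ z))) refl p K (1 + K ∸ p) _ ⟩
        p + (1 + K ∸ p) + (K + (K + sum (zeros bs)))
          ≡⟨ cong₂ (λ x y → x + (K + (K + y))) (m+[n∸m]≡n (≤-trans p≤K (n≤1+n K))) (sum-zeros bs) ⟩
        1 + K + (K + (K + 0))
          ≡⟨ solve 1 (λ K → con 1 :+ K :+ (K :+ (K :+ con 0)) := con 1 :+ K :* con 3) refl K ⟩
        1 + K * 3 ∎
        where
        open ≡.≡-Reasoning
        open +-*-Solver
    filling-alternative (b ∷ b′ ∷ []) _ with wt b ℕ.≟ 1 | wt b′ ℕ.≟ 1
    -- Both names have weight 1, so with no inflow at all the multiple 0 differs from both weights.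
    ... | yes e | yes e′ = p + K * 0 , low , 0 ∷ 0 ∷ [] , good e ∷ good e′ ∷ []
      , cong (p +_) (≡.sym (*-zeroʳ K)) , 3K p≤K z≤n
      where
      good : ∀ {b} → wt b ≡ 1 → Admissible b (p + K * 0) 0
      good e = z≤n , residue p 0 1≤p p≤K (inj₂ (inj₂ λ e′ → case trans (≡.sym e) e′ of λ ()))
    -- Residue `K` with multiple 1: the block whose name does not have weight 1 is good by that, and
    -- may give only `K ∸ p`; in the other block the top vertex itself sits at position `K`.
    ... | no ¬e | _ = K + K * 1 , middle , (K ∸ p) ∷ K ∷ []
      , (m∸n≤m K p , residue K 1 1≤K ≤-refl (inj₂ (inj₂ ¬e)))
        ∷ (≤-refl , residue K 1 1≤K ≤-refl (inj₂ (inj₁ refl))) ∷ []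
      , trans (≡.sym (+-assoc p _ _)) (cong₂ _+_ (m+[n∸m]≡n p≤K) (trans (+-identityʳ K) (≡.sym (*-identityʳ K))))
      , 3K ≤-refl (n≤1+n 1)
    ... | yes _ | no ¬e = K + K * 1 , middle , K ∷ (K ∸ p) ∷ []
      , (≤-refl , residue K 1 1≤K ≤-refl (inj₂ (inj₁ refl)))
        ∷ (m∸n≤m K p , residue K 1 1≤K ≤-refl (inj₂ (inj₂ ¬e))) ∷ []
      , trans (solve 3 (λ p K q → p :+ (K :+ (q :+ con 0)) := (p :+ q) :+ K :* con 1) refl p K (K ∸ p))
          (cong (_+ K * 1) (m+[n∸m]≡n p≤K))
      , 3K ≤-refl (n≤1+n 1)
      where open +-*-Solver

  Alternative⇒≢ : ∀ {p t} {1≤p : 1 ≤ p} {p≤K : p ≤ K} → Alternative 1≤p p≤K t → t ≢ p + K * 2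
  Alternative⇒≢ {1≤p = 1≤p} {p≤K} high eq with () ← proj₂ (residue-unique 3 2 ≤-refl 1≤K 1≤p p≤K eq)
  Alternative⇒≢ {1≤p = 1≤p} {p≤K} middle eq with () ← proj₂ (residue-unique 1 2 1≤K ≤-refl 1≤p p≤K eq)
  Alternative⇒≢ {1≤p = 1≤p} {p≤K} low eq with () ← proj₂ (residue-unique 0 2 1≤p p≤K 1≤p p≤K eq)

-- Weights from the leaves upwards, states from the roots downwards.

bounded : ∀ {n} (f : Fin n → ℕ) → ∃[ M ] ∀ u → f u ≤ M
bounded {zero}  f = 0 , λ ()
bounded {suc n} f with bounded (f ∘ Fin.suc)
... | M , f≤M = f Fin.zero ℕ.⊔ M , λ where
  Fin.zero    → m≤m⊔n (f Fin.zero) M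
  (Fin.suc u) → ≤-trans (f≤M u) (m≤n⊔m (f Fin.zero) M)

module TopDown {n : ℕ} (G : Graph n) (K : ℕ) (1≤K : 1 ≤ K) (F : CliqueForest G K ⊤) where

  open CliqueForest F
  open GraphTheory G using (edge-sym; edge⇒≢)
  open DecMembership (_≟_ {n}) using () renaming (_∈?_ to _∈ˡ?_)

  Parent : Fin n → Fin n → Set
  Parent u v = rk v ≢ 0 × par v ≡ u

  parent? : ∀ u v → Dec (Parent u v)
  parent? u v = ¬? (rk v ℕ.≟ 0) ×-dec par v ≟ u

  Parent-rk : ∀ {u v} → Parent u v → rk v ≡ suc (rk u)
  Parent-rk (v≢0 , refl) = rk-par ∈⊤ v≢0

  mates-rk : ∀ {u v} → cls u ≡ cls v → rk u ≡ rk v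
  mates-rk e = trans (≡.sym (rk-cls ∈⊤)) (trans (cong rk e) (rk-cls ∈⊤))

  mates-par : ∀ {u v} → cls u ≡ cls v → par u ≡ par v
  mates-par e = trans (≡.sym (par-cls ∈⊤)) (trans (cong par e) (par-cls ∈⊤))

  mates-Parent : ∀ {u v w} → cls u ≡ cls v → Parent w v → Parent w u
  mates-Parent e (v≢0 , p) = (λ u≡0 → v≢0 (trans (≡.sym (mates-rk e)) u≡0)) , trans (mates-par e) p

  mates⇒¬Parent : ∀ {u v} → cls u ≡ cls v → ¬ Parent u v
  mates⇒¬Parent e p = 1+n≢n (trans (≡.sym (Parent-rk p)) (≡.sym (mates-rk e)))

  Parent-asym : ∀ {u v} → Parent u v → ¬ Parent v u
  Parent-asym p q = <-asym (≤-reflexive (≡.sym (Parent-rk p))) (≤-reflexive (≡.sym (Parent-rk q)))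

  isBlock? : ∀ v b → Dec (cls b ≡ b × Parent v b)
  isBlock? v b = cls b ≟ b ×-dec parent? v b

  -- Each child block appears once, as the name of its class; hence the fixed-point condition on
  -- `cls`.
  blocks : Fin n → List (Fin n)
  blocks v = filter (isBlock? v) (allFin n)

  blocks-unique : ∀ v → Unique (blocks v)
  blocks-unique v = filter⁺ (isBlock? v) (allFin⁺ n)

  ∈-blocks : ∀ {u v} → Parent u v → cls v ∈ blocks u
  ∈-blocks {u} {v} p = ∈-filter⁺ (isBlock? u) (∈-allFin (cls v)) (cls-cls ∈⊤ , mates-Parent (cls-cls ∈⊤) p)

  blocks⇒ : ∀ {b v} → b ∈ blocks v → cls b ≡ b × Parent v b
  blocks⇒ {v = v} m = proj₂ (∈-filter⁻ (isBlock? v) {xs = allFin n} m)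

  class-size : ∀ {v} → rk v ≢ 0 → # (λ u → cls u ≟ cls v) ≡ K
  class-size {v} v≢0 = trans (#-cong (λ u → cls u ≟ cls v) (λ u → u ∈? ⊤ ×-dec cls u ≟ cls v) (∈⊤ ,_) proj₂)
    (size ∈⊤ v≢0)

  private
    M = proj₁ (bounded rk)

    -- The first argument bounds the height of the subtree below the vertex.
    weight : ℕ → Fin n → ℕ
    weight zero    v = 0
    weight (suc f) v = Fillings.weigh K 1≤K (weight f) (blocks v)

  wt : Fin n → ℕ
  wt v = weight (M ∸ rk v) v

  open Fillings K 1≤K wt

  -- If `M ∸ rk v` is 0, then `v` has maximal rank and no child blocks. Otherwise the children have
  -- rank one more, so the bound left for them is exactly the one used in their `wt`.
  wt-weigh : ∀ v → wt v ≡ weigh (blocks v)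
  wt-weigh v with M ∸ rk v in eq
  ... | zero  = lemma (blocks v) λ m → contradiction
    (≤-<-trans (m∸n≡0⇒m≤n eq) (≤-reflexive (≡.sym (Parent-rk (proj₂ (blocks⇒ m)))))) (≤⇒≯ (proj₂ (bounded rk) _))
    where
    lemma : ∀ bs → (∀ {b} → ¬ b ∈ bs) → 0 ≡ weigh bs
    lemma []      _ = refl
    lemma (b ∷ _) ∅ = contradiction (here refl) ∅
  ... | suc f = lemma (blocks v) λ {b} m → cong (λ f → weight f b) (trans (cong ℕ.pred (≡.sym eq))
    (trans (pred[m∸n]≡m∸[1+n] M (rk v)) (cong (M ∸_) (≡.sym (Parent-rk (proj₂ (blocks⇒ m)))))))
    where
    lemma : ∀ bs → (∀ {b} → b ∈ bs → weight f b ≡ wt b) → Fillings.weigh K 1≤K (weight f) bs ≡ weigh bs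
    lemma []          _ = refl
    lemma (b ∷ [])    h = cong (1 ∸_) (h (here refl))
    lemma (_ ∷ _ ∷ _) _ = refl

  wt≤2 : ∀ v → wt v ≤ 2
  wt≤2 v = subst (_≤ 2) (≡.sym (wt-weigh v)) (lemma (blocks v))
    where
    lemma : ∀ bs → weigh bs ≤ 2
    lemma []          = z≤n
    lemma (b ∷ [])    = ≤-trans (m∸n≤m 1 (wt b)) (n≤1+n 1)
    lemma (_ ∷ _ ∷ _) = ≤-refl

  -- What the downward pass fixes at `v`: its position in the parent block, the number of arcs from
  -- each child block, and the resulting indegree.
  record State (v : Fin n) : Set where
    field
      pos val : ℕ
      inflow  : Fin n → ℕ
      total   : pos + sum (map inflow (blocks v)) ≡ val
      bound   : val ≤ 1 + K * 3
      good    : ∀ {b} → b ∈ blocks v → Admissible b val (inflow b)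

  open State

  fill : ∀ {v p t} → Filling (blocks v) p t → State v
  fill {v} {p} {t} (ss , adm , total , bound) = record
    { pos = p ; val = t ; inflow = proj₁ s
    ; total = trans (cong (λ x → p + sum x) (proj₁ (proj₂ s))) total
    ; bound = bound ; good = proj₂ (proj₂ s) }
    where s = assign _≟_ (blocks-unique v) adm

  ordinary : ∀ v p → p ≤ K → State v
  ordinary v zero    _   = fill {p = 0} {0} (filling-0 (blocks v))
  ordinary v (suc p) p≤K = fill {p = suc p} {suc p + K * wt v}
    (subst (λ e → Filling (blocks v) (suc p) (suc p + K * e)) (≡.sym (wt-weigh v))
      (filling-weigh (s≤s z≤n) p≤K (blocks v)))

  ordinary-pos : ∀ v p p≤K → pos (ordinary v p p≤K) ≡ p
  ordinary-pos v zero    _ = refl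
  ordinary-pos v (suc p) _ = refl

  ordinary-residue : ∀ v p p≤K {r e} → 1 ≤ r → r ≤ K → val (ordinary v p p≤K) ≡ r + K * e → p ≡ r × wt v ≡ e
  ordinary-residue v zero    _   (s≤s _) _ ()
  ordinary-residue v (suc p) p≤K 1≤r r≤K eq = residue-unique (wt v) _ (s≤s z≤n) p≤K 1≤r r≤K eq

  ordinary-injective : ∀ u v p q p≤K q≤K → val (ordinary u p p≤K) ≡ val (ordinary v q q≤K) → p ≡ q
  ordinary-injective u v zero    zero    _   _   _  = refl
  ordinary-injective u v p       (suc q) p≤K q≤K eq = proj₁ (ordinary-residue u p p≤K (s≤s z≤n) q≤K eq)

  module _ (b : Fin n) where

    Class : Fin n → Set
    Class u = cls u ≡ b

    -- States for the class `b` below a parent at position `s` of their block with indegree `t`.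
    record Placed (s t : ℕ) : Set where
      field
        child   : ∀ u → State u
        pos≤    : ∀ u → pos (child u) ≤ K
        pos≢    : ∀ {u} → Class u → pos (child u) ≢ s
        pos-inj : InjectiveOn Class (λ u → pos (child u))
        val≢    : ∀ {u} → Class u → val (child u) ≢ t
        val-inj : InjectiveOn Class (λ u → val (child u))

    module _ {s t : ℕ} (b∈b : Class b) (#b : # (λ u → cls u ≟ b) ≡ K) (s≤K : s ≤ K) where

      module Pos = Positions {P? = λ u → cls u ≟ b} {#P = #b} {s≤K = s≤K}

      Arrangement : Set
      Arrangement = Positions (λ u → cls u ≟ b) #b s≤K

      place-ordinary : (π : Arrangement) →
        (∀ {u} → Class u → val (ordinary u (Pos.pos π u) (Pos.pos≤ π u)) ≢ t) → Placed s t
      place-ordinary π ≢t = record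
        { child   = λ u → ordinary u (Pos.pos π u) (Pos.pos≤ π u)
        ; pos≤    = λ u → subst (_≤ K) (≡.sym (same u)) (Pos.pos≤ π u)
        ; pos≢    = λ c e → Pos.pos≢ π c (trans (≡.sym (same _)) e)
        ; pos-inj = λ c d e → Pos.pos-inj π c d (trans (≡.sym (same _)) (trans e (same _)))
        ; val≢    = ≢t
        ; val-inj = λ c d e → Pos.pos-inj π c d (ordinary-injective _ _ _ _ _ _ e)
        }
        where same = λ u → ordinary-pos u (Pos.pos π u) (Pos.pos≤ π u)

      -- With all weights 2, only the vertex at position `r` would have indegree `t`. That vertex is
      -- `b`, which takes a second option; its multiple of `K` is not 2, so it meets neither `t` nor
      -- a sibling.
      place-alternative : ∀ {r} → 1 ≤ r → r ≤ K → (π : Arrangement) → Pos.pos π b ≡ r →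
        (∀ {u} → Class u → wt u ≡ 2) → t ≡ r + K * 2 → Placed s t
      place-alternative {r} 1≤r r≤K π πb all2 t≡
        with filling-alternative 1≤r r≤K (blocks b) (trans (≡.sym (wt-weigh b)) (all2 b∈b))
      ... | t′ , alt , filling = record
        { child   = child
        ; pos≤    = λ u → subst (_≤ K) (≡.sym (same u)) (Pos.pos≤ π u)
        ; pos≢    = λ c e → Pos.pos≢ π c (trans (≡.sym (same _)) e)
        ; pos-inj = λ c d e → Pos.pos-inj π c d (trans (≡.sym (same _)) (trans e (same _)))
        ; val≢    = val≢
        ; val-inj = val-inj
        }
        where
        ord : ∀ u → State u
        ord u = ordinary u (Pos.pos π u) (Pos.pos≤ π u)
        child : ∀ u → State u
        child u with u ≟ b
        ... | yes refl = fill {p = r} {t′} filling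
        ... | no _     = ord u
        same : ∀ u → pos (child u) ≡ Pos.pos π u
        same u with u ≟ b
        ... | yes refl = ≡.sym πb
        ... | no _     = ordinary-pos u _ _
        distinct : ∀ {u} → Class u → val (ord u) ≢ t′
        distinct {u} c eq = lemma alt eq
          where
          res : ∀ {r e} → 1 ≤ r → r ≤ K → val (ord u) ≡ r + K * e → Pos.pos π u ≡ r × wt u ≡ e
          res = ordinary-residue u (Pos.pos π u) (Pos.pos≤ π u)
          lemma : ∀ {t′} → Alternative 1≤r r≤K t′ → val (ord u) ≢ t′
          lemma high e   with () ← trans (≡.sym (all2 c)) (proj₂ (res ≤-refl 1≤K e))
          lemma middle e with () ← trans (≡.sym (all2 c)) (proj₂ (res 1≤K ≤-refl e))
          lemma low e    with () ← trans (≡.sym (all2 c)) (proj₂ (res 1≤r r≤K e))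
        val≢ : ∀ {u} → Class u → val (child u) ≢ t
        val≢ {u} c eq with u ≟ b
        ... | yes refl = Alternative⇒≢ alt (trans eq t≡)
        ... | no u≢b   = u≢b (Pos.pos-inj π c b∈b
          (trans (proj₁ (ordinary-residue u _ _ 1≤r r≤K (trans eq t≡))) (≡.sym πb)))
        val-inj : InjectiveOn Class (λ u → val (child u))
        val-inj {u} {v} c d eq with u ≟ b | v ≟ b
        ... | yes refl | yes refl = refl
        ... | yes refl | no _     = contradiction (≡.sym eq) (distinct d)
        ... | no _     | yes refl = contradiction eq (distinct c)
        ... | no _     | no _     = Pos.pos-inj π c d (ordinary-injective _ _ _ _ _ _ eq)

      private
        arrangement = positions (λ u → cls u ≟ b) #b s≤K

      place-at-top : ∀ {r e} → 1 ≤ r → r ≤ K → s ≡ r → t ≡ r + K * e → Placed s t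
      place-at-top 1≤r r≤K s≡r t≡ = place-ordinary arrangement λ c eq → Pos.pos≢ arrangement c
        (trans (proj₁ (ordinary-residue _ _ _ 1≤r r≤K (trans eq t≡))) (≡.sym s≡r))

      -- Only a child of weight `e` at position `r` can collide with the parent. Either the parent
      -- holds `r`, or a child of another weight is put there, or all children have weight `e`; then
      -- `Good` leaves just `2 ≤ e`, and `wt≤2` gives `e ≡ 2`.
      place : Good b s t → Placed s t
      -- Indegree 0 would need position 0, which the parent occupies.
      place (vanishing refl) = place-ordinary arrangement λ {u} c eq →
        Pos.pos≢ arrangement c (ordinary-injective u u _ 0 _ z≤n eq)
      place (residue r e 1≤r r≤K why) with s ℕ.≟ r | any? (λ u → cls u ≟ b ×-dec ¬? (wt u ℕ.≟ e))
      ... | yes s≡r | _ = place-at-top {e = e} 1≤r r≤K s≡r refl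
      ... | no s≢r | yes (m , c , ≢e) with positions-at (λ u → cls u ≟ b) #b s≤K c r≤K (s≢r ∘ ≡.sym)
      ...   | π , πm = place-ordinary π unequal
        where
        unequal : ∀ {u} → Class u → val (ordinary u (Pos.pos π u) (Pos.pos≤ π u)) ≢ r + K * e
        unequal d eq with ordinary-residue _ _ _ 1≤r r≤K eq
        ... | p≡r , wt≡e with refl ← Pos.pos-inj π c d (trans πm (≡.sym p≡r)) = ≢e wt≡e
      place (residue r e 1≤r r≤K why) | no s≢r | no none =
        place-alternative 1≤r r≤K (proj₁ at) (proj₂ at)
          (λ c → trans (all-e c) e≡2) (cong (λ e → r + K * e) e≡2)
        where
        at = positions-at (λ u → cls u ≟ b) #b s≤K b∈b r≤K (s≢r ∘ ≡.sym)
        all-e : ∀ {u} → Class u → wt u ≡ e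
        all-e {u} c with wt u ℕ.≟ e
        ... | yes wt≡e = wt≡e
        ... | no wt≢e  = contradiction (u , c , wt≢e) none
        forced : 2 ≤ e ⊎ s ≡ r ⊎ wt b ≢ e → e ≡ 2
        forced (inj₁ 2≤e)         = ≤-antisym (subst (_≤ 2) (all-e b∈b) (wt≤2 b)) 2≤e
        forced (inj₂ (inj₁ s≡r))  = contradiction s≡r s≢r
        forced (inj₂ (inj₂ wt≢e)) = contradiction (all-e b∈b) wt≢e
        e≡2 = forced why

  open Placed

  placed : ∀ {w b} (σ : State w) → b ∈ blocks w → Placed b (inflow σ b) (val σ)
  placed σ m with blocks⇒ m | good σ m
  ... | cls-b , b≢0 , _ | s≤K , g =
    place _ cls-b (trans (cong (λ c → # (λ u → cls u ≟ c)) (≡.sym cls-b)) (class-size b≢0)) s≤K g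

  next : ∀ {w} → State w → ∀ b → Dec (b ∈ blocks w) → ∀ u → State u
  next σ b (yes m) = child (placed σ m)
  -- A default only: the class of a non-root is always among the blocks of its parent.
  next σ b (no _)  = λ u → ordinary u 0 z≤n

  state-at : ℕ → ∀ v → State v
  state-at zero    v = ordinary v 0 z≤n
  state-at (suc i) v = next (state-at i (par v)) (cls v) (cls v ∈ˡ? blocks (par v)) v

  state : ∀ v → State v
  state v = state-at (rk v) v

  position indegree flow : Fin n → ℕ
  position v = pos (state v)
  indegree v = val (state v)
  flow v     = inflow (state (par v)) (cls v)

  next-at : ∀ i u {w b} → par u ≡ w → cls u ≡ b →
    state-at (suc i) u ≡ next (state-at i w) b (b ∈ˡ? blocks w) u
  next-at i u refl refl = refl

  -- Classmates compute their states separately, but share rank, parent and class name. So all these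
  -- states come from one placement `D`, whose injectivity then applies to them.
  state-child : ∀ {v} → rk v ≢ 0 → ∃[ D ] ∀ {u} → cls u ≡ cls v →
    state u ≡ child {cls v} {flow v} {indegree (par v)} D u
  state-child {v} v≢0 with cls v ∈ˡ? blocks (par v) in dec
  ... | no ∉  = contradiction (∈-blocks (v≢0 , refl)) ∉
  ... | yes m = placed (state (par v)) m , λ {u} c → begin
    state-at (rk u) u              ≡⟨ cong (λ i → state-at i u) (Parent-rk (mates-Parent c (v≢0 , refl))) ⟩
    state-at (suc (rk (par v))) u  ≡⟨ next-at (rk (par v)) u (mates-par c) c ⟩
    next (state (par v)) (cls v) (cls v ∈ˡ? blocks (par v)) u
                                   ≡⟨ cong (λ d → next (state (par v)) (cls v) d u) dec ⟩
    child (placed (state (par v)) m) u ∎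
    where open ≡.≡-Reasoning

  -- Order within a block and the counts it determines.

  module _ {v : Fin n} (v≢0 : rk v ≢ 0) where
    private
      D = proj₁ (state-child v≢0)
      same : ∀ {u} → cls u ≡ cls v → state u ≡ child D u
      same = proj₂ (state-child v≢0)

      along : ∀ {u} (f : ∀ {u} → State u → ℕ) → cls u ≡ cls v → f (state u) ≡ f (child D u)
      along f c = cong f (same c)

    position≤K : ∀ {u} → cls u ≡ cls v → position u ≤ K
    position≤K c = subst (_≤ K) (≡.sym (along pos c)) (pos≤ D _)

    position≢flow : ∀ {u} → cls u ≡ cls v → position u ≢ flow v
    position≢flow c e = pos≢ D c (trans (≡.sym (along pos c)) e)

    position-injective : InjectiveOn (λ u → cls u ≡ cls v) position
    position-injective c d e = pos-inj D c d (trans (≡.sym (along pos c)) (trans e (along pos d)))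

    indegree≢ : ∀ {u} → cls u ≡ cls v → indegree u ≢ indegree (par v)
    indegree≢ c e = val≢ D c (trans (≡.sym (along val c)) e)

    indegree-injective : InjectiveOn (λ u → cls u ≡ cls v) indegree
    indegree-injective c d e = val-inj D c d (trans (≡.sym (along val c)) (trans e (along val d)))

    flow≤K : flow v ≤ K
    flow≤K = proj₁ (good (state (par v)) (∈-blocks (v≢0 , refl)))

    private
      InBlock : Fin n → Set
      InBlock u = cls u ≡ cls v ⊎ u ≡ par v

      inBlock? : Decidable InBlock
      inBlock? u = cls u ≟ cls v ⊎-dec u ≟ par v

      -- The linear order of the whole block, with the parent inserted at the free position
      -- `flow v`.
      place-of : Fin n → ℕ
      place-of u with cls u ≟ cls v
      ... | yes _ = position u
      ... | no _  = flow v

      place-of-mate : ∀ {u} → cls u ≡ cls v → place-of u ≡ position u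
      place-of-mate {u} c with cls u ≟ cls v
      ... | yes _ = refl
      ... | no ¬c = contradiction c ¬c

      par≁ : cls (par v) ≢ cls v
      par≁ c = mates⇒¬Parent c (v≢0 , refl)

      place-of-par : place-of (par v) ≡ flow v
      place-of-par with cls (par v) ≟ cls v
      ... | yes c = contradiction c par≁
      ... | no _  = refl

      place-of≤K : ∀ {u} → InBlock u → place-of u < suc K
      place-of≤K (inj₁ c)    = s≤s (subst (_≤ K) (≡.sym (place-of-mate c)) (position≤K c))
      place-of≤K (inj₂ refl) = s≤s (subst (_≤ K) (≡.sym place-of-par) flow≤K)

      place-of-injective : InjectiveOn InBlock place-of
      place-of-injective (inj₁ c) (inj₁ d) e =
        position-injective c d (trans (≡.sym (place-of-mate c)) (trans e (place-of-mate d)))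
      place-of-injective (inj₁ c) (inj₂ refl) e =
        contradiction (trans (≡.sym (place-of-mate c)) (trans e place-of-par)) (position≢flow c)
      place-of-injective (inj₂ refl) (inj₁ d) e =
        contradiction (trans (≡.sym (place-of-mate d)) (trans (≡.sym e) place-of-par)) (position≢flow d)
      place-of-injective (inj₂ refl) (inj₂ refl) _ = refl

      #inBlock : # inBlock? ≡ suc K
      #inBlock = trans (#-⊎ (λ u → cls u ≟ cls v) (_≟ par v) inBlock? id inj₁ inj₂ λ { c refl → par≁ c })
        (trans (cong₂ _+_ (class-size v≢0) (#-singleton (par v))) (+-comm K 1))

      #before : ∀ {p} → p ≤ K → # (λ u → inBlock? u ×-dec place-of u <? p) ≡ p
      #before p≤K = #-initial inBlock? place-of place-of-injective #inBlock place-of≤K (≤-trans p≤K (n≤1+n K))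

    -- The vertices preceding the parent in the block order are all mates of `v`, and the parent's
    -- place `flow v` counts them.
    #-below-flow : # (λ u → cls u ≟ cls v ×-dec position u <? flow v) ≡ flow v
    #-below-flow = trans (#-cong (λ u → cls u ≟ cls v ×-dec position u <? flow v)
        (λ u → inBlock? u ×-dec place-of u <? flow v)
        (λ (c , l) → inj₁ c , subst (_< flow v) (≡.sym (place-of-mate c)) l)
        λ { (inj₁ c , l) → c , subst (_< flow v) (place-of-mate c) l
          ; (inj₂ refl , l) → contradiction (subst (_< flow v) place-of-par l) (<-irrefl refl) })
      (#before flow≤K)

    #-below-position :
      # (λ u → (cls u ≟ cls v ×-dec position u <? position v) ⊎-dec (parent? u v ×-dec flow v <? position v))
        ≡ position v
    #-below-position = trans (#-cong
        (λ u → (cls u ≟ cls v ×-dec position u <? position v) ⊎-dec (parent? u v ×-dec flow v <? position v))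
        (λ u → inBlock? u ×-dec place-of u <? position v)
        (λ { (inj₁ (c , l)) → inj₁ c , subst (_< position v) (≡.sym (place-of-mate c)) l
           ; (inj₂ ((_ , refl) , l)) → inj₂ refl , subst (_< position v) (≡.sym place-of-par) l })
        λ { (inj₁ c , l) → inj₁ (c , subst (_< position v) (place-of-mate c) l)
          ; (inj₂ refl , l) → inj₂ ((v≢0 , refl) , subst (_< position v) place-of-par l) })
      (#before (position≤K refl))

  root-position : ∀ {v} → rk v ≡ 0 → position v ≡ 0
  root-position {v} v≡0 = cong (λ i → pos (state-at i v)) v≡0

  -- The orientation, its indegrees and its properness.

  -- An arc goes from the earlier to the later vertex of a block. `Up v` collects the in-neighbours
  -- of `v` in its parent block, `Down v` those in its child blocks.
  Up Down Arc : Fin n → Fin n → Set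
  Up v u   = (cls u ≡ cls v × position u < position v) ⊎ (Parent u v × flow v < position v)
  Down v u = Parent v u × position u < flow u
  Arc u v  = Up v u ⊎ Down v u

  up? : ∀ v u → Dec (Up v u)
  up? v u = (cls u ≟ cls v ×-dec position u <? position v) ⊎-dec (parent? u v ×-dec flow v <? position v)

  down? : ∀ v u → Dec (Down v u)
  down? v u = parent? v u ×-dec position u <? flow u

  arc? : ∀ u v → Dec (Arc u v)
  arc? u v = up? v u ⊎-dec down? v u

  #up : ∀ v → # (up? v) ≡ position v
  #up v with rk v ℕ.≟ 0
  ... | no v≢0  = #-below-position v≢0
  ... | yes v≡0 = trans (#-∅ (up? v) none) (≡.sym (root-position v≡0))
    where
    none : ∀ {u} → ¬ Up v u
    none (inj₁ (_ , l))       = n≮0 (subst (_ <_) (root-position v≡0) l)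
    none (inj₂ ((v≢0 , _) , _)) = v≢0 v≡0

  #down : ∀ v → # (down? v) ≡ sum (map (inflow (state v)) (blocks v))
  #down v = #-fibres (down? v) cls (inflow (state v)) (blocks-unique v) (λ (p , _) → ∈-blocks p) fibre
    where
    fibre : ∀ {b} → b ∈ blocks v → # (λ u → down? v u ×-dec cls u ≟ b) ≡ inflow (state v) b
    fibre {b} m with blocks⇒ m
    ... | cls-b , b≢0 , refl = trans (#-cong (λ u → down? v u ×-dec cls u ≟ b)
        (λ u → cls u ≟ cls b ×-dec position u <? flow b)
        (λ { {u} ((p , l) , refl) → ≡.sym cls-b , subst (position u <_) (flow-mate (≡.sym cls-b)) l })
        (λ {u} (c , l) →
          (mates-Parent c (b≢0 , refl) , subst (position u <_) (≡.sym (flow-mate c)) l) , trans c cls-b))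
      (trans (#-below-flow b≢0) (cong (inflow (state v)) cls-b))
      where
      flow-mate : ∀ {u} → cls u ≡ cls b → flow u ≡ flow b
      flow-mate c = cong₂ (λ w b → inflow (state w) b) (mates-par c) c

  #arc : ∀ v → # (λ u → arc? u v) ≡ indegree v
  #arc v = trans (#-⊎ (up? v) (down? v) (λ u → arc? u v) id inj₁ inj₂ disjoint)
    (trans (cong₂ _+_ (#up v) (#down v)) (total (state v)))
    where
    disjoint : ∀ {u} → Up v u → ¬ Down v u
    disjoint (inj₁ (c , _)) (p , _) = mates⇒¬Parent (≡.sym c) p
    disjoint (inj₂ (p , _)) (q , _) = Parent-asym p q

  Parent-edge : ∀ {u v} → Parent u v → Edge G u v
  Parent-edge (v≢0 , refl) = edge-par ∈⊤ v≢0

  Arc-edge : ∀ {u v} → Arc u v → Edge G u v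
  Arc-edge (inj₁ (inj₁ (c , l))) = edge-cls ∈⊤ ∈⊤ c λ { refl → <-irrefl refl l }
  Arc-edge (inj₁ (inj₂ (p , _))) = Parent-edge p
  Arc-edge (inj₂ (p , _))        = edge-sym (Parent-edge p)

  Arc-asym : ∀ {u v} → Arc u v → ¬ Arc v u
  Arc-asym (inj₁ (inj₁ (_ , l))) (inj₁ (inj₁ (_ , m))) = <-asym l m
  Arc-asym (inj₁ (inj₁ (c , _))) (inj₁ (inj₂ (p , _))) = mates⇒¬Parent (≡.sym c) p
  Arc-asym (inj₁ (inj₁ (c , _))) (inj₂ (p , _))        = mates⇒¬Parent c p
  Arc-asym (inj₁ (inj₂ (p , _))) (inj₁ (inj₁ (c , _))) = mates⇒¬Parent (≡.sym c) p
  Arc-asym (inj₁ (inj₂ (p , _))) (inj₁ (inj₂ (q , _))) = Parent-asym p q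
  Arc-asym (inj₁ (inj₂ (_ , l))) (inj₂ (_ , m))        = <-asym l m
  Arc-asym (inj₂ (p , _))        (inj₁ (inj₁ (c , _))) = mates⇒¬Parent c p
  Arc-asym (inj₂ (_ , l))        (inj₁ (inj₂ (_ , m))) = <-asym l m
  Arc-asym (inj₂ (p , _))        (inj₂ (q , _))        = Parent-asym p q

  mates-root : ∀ {u v} → cls u ≡ cls v → rk v ≡ 0 → u ≡ v
  mates-root c v≡0 = trans (≡.sym (root ∈⊤ (trans (mates-rk c) v≡0))) (trans c (root ∈⊤ v≡0))

  mates-nonroot : ∀ {u v} → Edge G u v → cls u ≡ cls v → rk v ≢ 0
  mates-nonroot e c v≡0 = edge⇒≢ e (mates-root c v≡0)

  -- A tie cannot occur, since the parent's place `flow v` is taken by no child.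
  Parent-total : ∀ {u v} → Parent u v → Arc u v ⊎ Arc v u
  Parent-total {u} {v} p with <-cmp (flow v) (position v)
  ... | tri< l _ _ = inj₁ (inj₁ (inj₂ (p , l)))
  ... | tri≈ _ e _ = contradiction (≡.sym e) (position≢flow (proj₁ p) refl)
  ... | tri> _ _ l = inj₂ (inj₂ (p , l))

  Arc-total : ∀ {u v} → Edge G u v → Arc u v ⊎ Arc v u
  Arc-total {u} {v} e with edges ∈⊤ ∈⊤ e
  ... | inj₂ (inj₁ p) = Parent-total p
  ... | inj₂ (inj₂ p) = [ inj₂ , inj₁ ]′ (Parent-total p)
  ... | inj₁ c with <-cmp (position u) (position v)
  ...   | tri< l _ _ = inj₁ (inj₁ (inj₁ (c , l)))
  ...   | tri> _ _ l = inj₂ (inj₁ (inj₁ (≡.sym c , l)))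
  ...   | tri≈ _ p≡ _ = contradiction (position-injective (mates-nonroot e c) c refl p≡) (edge⇒≢ e)

  orientation : Orientation G
  orientation = record
    { arc      = λ u v → does (arc? u v)
    ; arc-edge = λ u v a → Arc-edge (does⇒ (arc? u v) a)
    ; one-dir  = λ u v e → case Arc-total e of λ where
        (inj₁ a) → inj₁ (dec-true (arc? u v) a , dec-false (arc? v u) (Arc-asym a))
        (inj₂ a) → inj₂ (dec-false (arc? u v) (Arc-asym a) , dec-true (arc? v u) a)
    }

  indegree-proper : ∀ {u v} → Edge G u v → indegree u ≢ indegree v
  indegree-proper e d with edges ∈⊤ ∈⊤ e
  ... | inj₁ c                      = edge⇒≢ e (indegree-injective (mates-nonroot e c) c refl d)
  ... | inj₂ (inj₁ (v≢0 , refl))    = indegree≢ v≢0 refl (≡.sym d)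
  ... | inj₂ (inj₂ (u≢0 , refl))    = indegree≢ u≢0 refl d

  properOrientation : ProperOrientationNumber≤ G (1 + K * 3)
  properOrientation = orientation
    , (λ u v e d → indegree-proper e (trans (≡.sym (#arc u)) (trans d (#arc v))))
    , λ v → subst (_≤ 1 + K * 3) (≡.sym (#arc v)) (bound (state v))

-- Edgeless graphs and the final bound.

edgeless : ∀ {n} (G : Graph n) {k} → (∀ {u v} → ¬ Edge G u v) → ProperOrientationNumber≤ G k
edgeless {n} G {k} none = record
  { arc      = λ _ _ → false
  ; arc-edge = λ _ _ ()
  ; one-dir  = λ _ _ e → contradiction e none
  } , (λ _ _ e → contradiction e none)
    , λ _ → subst (_≤ k) (≡.sym (#-∅ {n} {λ _ → ⊥} (λ _ → no id) id)) z≤n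

edge⇒2≤ω : ∀ {n} (G : Graph n) {k} → CliqueNumber G k → ∀ {u v} → Edge G u v → 2 ≤ k
edge⇒2≤ω G {k} (_ , max) {u} {v} e = subst (_≤ k)
  (trans (#-⊎ (_≟ u) (_≟ v) UV? id inj₁ inj₂ λ { refl refl → edge⇒≢ e refl })
    (cong₂ _+_ (#-singleton u) (#-singleton v)))
  (max ⟦ UV? ⟧ λ x y x∈ y∈ → clique (∈⟦⟧⁻ UV? x∈) (∈⟦⟧⁻ UV? y∈))
  where
  open GraphTheory G
  UV? = λ x → x ≟ u ⊎-dec x ≟ v
  clique : ∀ {x y} → x ≡ u ⊎ x ≡ v → y ≡ u ⊎ y ≡ v → x ≢ y → Edge G x y
  clique (inj₁ refl) (inj₁ refl) x≢y = contradiction refl x≢y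
  clique (inj₁ refl) (inj₂ refl) _   = e
  clique (inj₂ refl) (inj₁ refl) _   = edge-sym e
  clique (inj₂ refl) (inj₂ refl) x≢y = contradiction refl x≢y

theorem22 : ∀ {n : ℕ} (G : Graph n) (k : ℕ) →
    UniformBlockGraph G k →
    ProperOrientationNumber≤ G (3 * k ∸ 2)
-- For k at most 1 there are no edges, since an edge is a clique of size 2.
theorem22 G zero (_ , ω , _) = edgeless G λ e → contradiction (edge⇒2≤ω G ω e) λ ()
theorem22 G (suc zero) (_ , ω , _) = edgeless G λ e → contradiction (edge⇒2≤ω G ω e) λ { (s≤s ()) }
theorem22 G (suc K@(suc _)) (blockGraph , _ , uniform) =
  -- `suc K * 3 ∸ 2` computes to `1 + K * 3`, so only commutativity is needed.
  subst (ProperOrientationNumber≤ G) (cong (_∸ 2) (*-comm (suc K) 3))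
    (TopDown.properOrientation G K (s≤s z≤n) (Build.cliqueForest G K blockGraph uniform))
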